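{- Let $G$ be an $n$-vertex, $K_{r+1}$-free graph where $r \ge 3$. For every $k \ge 0$, if $G$ is not $k$-path Hamiltonian and $$n \ge \begin{cases} 6k+26 & \text{if } r=3\\ 5k+11 & \text{if } 4 \le r \le 7\\ k+5+ 4(k+4)/(r-4) & \text{if } r \ge 8,\end{cases}$$ then $e(G) \leq e(T_r(n-1)) + (k+1)$. The set $\mathcal{J}^k_{n,r}$ is nonempty, and equality holds if $G \in \mathcal{J}^k_{n,r}$.
   Context: Graphs are finite and simple; $n,r,k$ are integers; $e(G)$ is the number of edges of $G$. $T_r(n)$ is the $n$-vertex, $r$-partite Turán graph: the complete $r$-partite graph on $n$ vertices with part sizes differing by at most 1 (if $n<r$ some parts are empty and it is $K_n$). An $n$-vertex graph is $k$-path Hamiltonian ($0 \le k \le n-2$) if every path of length (number of edges) at most $k$ is contained in a Hamiltonian cycle. A graph is traceable if it contains a Hamiltonian path. $\mathcal{J}^k_{n,r}$ is the set of $n$-vertex, $K_{r+1}$-free graphs consisting of $T_r(n-1)$ plus one additional vertex of degree $k+1$ whose neighborhood (i.e., the subgraph induced by its set of neighbors) is traceable. -}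

module Defs where

open import Level using (0ℓ)
open import Data.Nat using (ℕ; zero; suc; _≤_; NonZero)
open import Data.Nat.DivMod using (_mod_)
open import Data.Fin using (Fin; toℕ; punchIn; _<?_; _≟_)
open import Data.List using (List; []; _∷_; _∷ʳ_; length; filter; lookup; allFin; cartesianProduct)
open import Data.List.Membership.Propositional using (_∈_)
open import Data.List.Relation.Binary.Subset.Propositional using (_⊆_)
open import Data.List.Relation.Unary.Linked using (Linked)
open import Data.List.Relation.Unary.Unique.Propositional using (Unique)
open import Data.Product using (Σ; ∃; _×_; _,_; proj₁; proj₂)
open import Data.Sum using (_⊎_)
open import Data.Empty using (⊥)
open import Function using (_∘_; _on_)
open import Function.Bundles using (_↔_; _⇔_; module Inverse)
open import Function.Definitions using (Injective)
open import Relation.Binary.Core using (Rel)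
open import Relation.Binary.Definitions using (Decidable; Symmetric; Irreflexive)
open import Relation.Binary.PropositionalEquality using (_≡_; _≢_; refl; sym)
open import Relation.Nullary using (¬_)
open import Relation.Nullary.Decidable using (_×-dec_; ¬?)

record Graph (n : ℕ) : Set₁ where
  field
    Adj    : Rel (Fin n) 0ℓ
    adj?   : Decidable Adj
    symm   : Symmetric Adj
    irrefl : Irreflexive _≡_ Adj

open Graph public

-- Each edge {i , j} is counted once, through its representative with i < j.
e : ∀ {n} → Graph n → ℕ
e {n} G = length (filter (λ p → (proj₁ p <? proj₂ p) ×-dec adj? G (proj₁ p) (proj₂ p))
                         (cartesianProduct (allFin n) (allFin n)))

-- The subgraph induced by the vertices f 0, f 1, …; f is injective at every
-- use below.
induced : ∀ {m n} → Graph n → (Fin m → Fin n) → Graph m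
induced G f = record
  { Adj    = Adj G on f
  ; adj?   = λ i j → adj? G (f i) (f j)
  ; symm   = symm G
  ; irrefl = λ { refl → irrefl G refl }
  }

infixl 6 _-ᵥ_
_-ᵥ_ : ∀ {m} → Graph (suc m) → Fin (suc m) → Graph m
G -ᵥ v = induced G (punchIn v)

record _≅_ {m n} (G : Graph m) (H : Graph n) : Set where
  field
    bij     : Fin m ↔ Fin n
    adj-iff : ∀ i j → Adj G i j ⇔ Adj H (Inverse.to bij i) (Inverse.to bij j)

completeMultipartite : ∀ {n r} → (Fin n → Fin r) → Graph n
completeMultipartite part = record
  { Adj    = λ i j → part i ≢ part j
  ; adj?   = λ i j → ¬? (part i ≟ part j)
  ; symm   = λ i≁j → i≁j ∘ sym
  ; irrefl = λ { refl i≁i → i≁i refl }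
  }

-- The Turán graph T_r(n).  The parts are the residue classes mod r of
-- 0, …, n - 1, whose sizes differ by at most one.
T : (r n : ℕ) → .{{_ : NonZero r}} → Graph n
T r n = completeMultipartite (λ (i : Fin n) → toℕ i mod r)

K : (m : ℕ) → Graph m
K m = completeMultipartite (λ (i : Fin m) → i)

-- H is isomorphic to a (not necessarily induced) subgraph of G.
record _↪_ {m n} (H : Graph m) (G : Graph n) : Set where
  field
    emb       : Fin m → Fin n
    injective : Injective _≡_ _≡_ emb
    preserves : ∀ i j → Adj H i j → Adj G (emb i) (emb j)

_Free_ : ∀ {m n} → Graph m → Graph n → Set
H Free G = ¬ (H ↪ G)

record Path {n} (G : Graph n) : Set where
  field
    start    : Fin n
    rest     : List (Fin n)
    distinct : Unique (start ∷ rest)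
    linked   : Linked (Adj G) (start ∷ rest)

  walk : List (Fin n)
  walk = start ∷ rest

  edgeLength : ℕ
  edgeLength = length rest

record Cycle {n} (G : Graph n) : Set where
  field
    start    : Fin n
    rest     : List (Fin n)
    distinct : Unique (start ∷ rest)
    linked   : Linked (Adj G) (start ∷ rest ∷ʳ start)
    ≥3       : 3 ≤ length (start ∷ rest)

  vertices : List (Fin n)
  vertices = start ∷ rest

  closedWalk : List (Fin n)
  closedWalk = start ∷ rest ∷ʳ start

HamiltonianPath : ∀ {n} → Graph n → Set
HamiltonianPath G = Σ (Path G) λ P → ∀ v → v ∈ Path.walk P

HamiltonianCycle : ∀ {n} → Graph n → Set
HamiltonianCycle G = Σ (Cycle G) λ C → ∀ v → v ∈ Cycle.vertices C

Traceable : ∀ {n} → Graph n → Set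
Traceable = HamiltonianPath

steps : ∀ {A : Set} → List A → List (A × A)
steps []           = []
steps (x ∷ [])     = []
steps (x ∷ y ∷ zs) = (x , y) ∷ steps (y ∷ zs)

-- Containment as subgraphs; edges are unordered, so the cycle may traverse
-- them in either direction.
record _ContainedIn_ {n} {G : Graph n} (P : Path G) (C : Cycle G) : Set where
  field
    vertices⊆ : Path.walk P ⊆ Cycle.vertices C
    edges⊆    : ∀ {a b} → (a , b) ∈ steps (Path.walk P) →
                (a , b) ∈ steps (Cycle.closedWalk C) ⊎ (b , a) ∈ steps (Cycle.closedWalk C)

-- Meaningful for k ≤ n - 2.
_-PathHamiltonian_ : ∀ {n} → ℕ → Graph n → Set
k -PathHamiltonian G = ∀ (P : Path G) → Path.edgeLength P ≤ k →
  Σ (HamiltonianCycle G) λ H → P ContainedIn proj₁ H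

neighbours : ∀ {n} → Graph n → Fin n → List (Fin n)
neighbours {n} G v = filter (adj? G v) (allFin n)

degree : ∀ {n} → Graph n → Fin n → ℕ
degree G v = length (neighbours G v)

neighbourhood : ∀ {n} (G : Graph n) (v : Fin n) → Graph (degree G v)
neighbourhood G v = induced G (lookup (neighbours G v))

-- 𝒥 r k {n} G says that G belongs to 𝒥^k_{n,r}, closed under isomorphism.
𝒥 : (r k : ℕ) → .{{_ : NonZero r}} → ∀ {n} → Graph n → Set
𝒥 r k {zero}  G = ⊥
𝒥 r k {suc m} G = (K (suc r) Free G) × ∃ λ v →
  ((G -ᵥ v) ≅ T r m) × degree G v ≡ suc k × Traceable (neighbourhood G v)

{-# OPTIONS --safe #-}

-- If G has more edges than claimed, then few of its vertices have small degree: deleting q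
-- vertices of degree at most j leaves a K_{r+1}-free graph, so e(G) ≤ e(T_r(n-q)) + q j by Turán's
-- theorem, and for a suitable q the bound on n makes this at most e(T_r(n-1)) + k + 1 as soon as
-- 2j < n + k and at least max(1, j - k) vertices have degree at most j.  On the other hand, a
-- graph with no such j is k-path Hamiltonian by a Chvátal-type argument.  Call x and y heavy if
-- d(x) + d(y) ≥ n + k.  A cyclic arrangement of the vertices that contains a given path and whose
-- gaps are all heavy pairs can be repaired by reversing segments outside the path, so heavy pairs
-- may be added to the graph as edges; once this is no longer possible, a graph that is still not
-- complete has a non-adjacent pair whose degrees exhibit a forbidden j.
--
-- In the extremal graphs the Hamiltonian path of N(v) lies in no Hamiltonian cycle: removing v
-- and a vertex z outside N(v) cuts such a cycle into two arcs, the path stays inside one of them,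
-- yet each arc contains a neighbour of v.

module Submission where

open import Algebra.Properties.CommutativeSemigroup using (interchange; x∙yz≈y∙xz)
open import Data.Empty using (⊥; ⊥-elim)
open import Data.Fin using (Fin; zero; suc; toℕ; punchIn; punchOut; _≟_)
import Data.Fin as Fin
open import Data.Fin.Properties using (any?; pigeonhole; punchIn-injective; punchInᵢ≢i; punchIn-punchOut; toℕ-fromℕ<)
open import Data.List using (List; []; _∷_; _++_; _∷ʳ_; length; map; filter; reverse; take; drop; lookup; allFin; upTo; downFrom; applyUpTo; tabulate; cartesianProduct)
open import Data.List.Membership.Propositional using (_∈_; _∉_; find; lose)
open import Data.List.Membership.Propositional.Properties
open import Data.List.Membership.Propositional.Properties.WithK using (unique∧set⇒bag)
open import Data.List.Properties
open import Data.List.Relation.Binary.BagAndSetEquality using (∼bag⇒↭)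
open import Data.List.Relation.Binary.Permutation.Propositional using (_↭_; ↭-refl; ↭-reflexive; ↭-sym; ↭-trans; ↭⇒↭ₛ; prep; swap; refl; trans)
open import Data.List.Relation.Binary.Permutation.Propositional.Properties using (filter-↭; ↭-length; shift; All-resp-↭; ∈-resp-↭; ↭-reverse; ++⁺ˡ; ++⁺ʳ; ∷↭∷ʳ) renaming (++-comm to ↭-++-comm)
import Data.List.Relation.Binary.Permutation.Setoid.Properties as Setoid↭
open import Data.List.Relation.Unary.All as All using (All; []; _∷_)
open import Data.List.Relation.Unary.All.Properties using (¬Any⇒All¬; ¬All⇒Any¬) renaming (++⁺ to All-++⁺; ++⁻ to All-++⁻; map⁺ to All-map⁺)
open import Data.List.Relation.Unary.AllPairs using (AllPairs; []; _∷_)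
open import Data.List.Relation.Unary.AllPairs.Properties using () renaming (tabulate⁺-< to AllPairs-tabulate⁺-<)
open import Data.List.Relation.Unary.Any as Any using (Any; here; there)
open import Data.List.Relation.Unary.Any.Properties using (lookup-index)
open import Data.List.Relation.Unary.Linked as Linked using (Linked; []; [-]; _∷_)
import Data.List.Relation.Unary.Linked.Properties as Linked
open import Data.List.Relation.Unary.Unique.Propositional using (Unique)
open import Data.List.Relation.Unary.Unique.Propositional.Properties using (allFin⁺; filter⁺) renaming (map⁺ to Unique-map⁺)
open import Data.Nat hiding (_≟_)
import Data.Nat as ℕ
open import Data.Nat.DivMod using (_mod_; [m+kn]%n≡m%n; m%n<n; m<n⇒m%n≡m; m≤n⇒[n∸m]%m≡n%m; m≡m%n+[m/n]*n; m/n*n≤m; m<n*o⇒m/o<n)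
open import Data.Nat.Properties hiding (_≟_)
open import Data.Nat.Tactic.RingSolver using (solve-∀)
open import Data.Product using (Σ; ∃; ∃₂; _×_; _,_; proj₁; proj₂; uncurry) renaming (swap to swap×)
open import Data.Sum as Sum using (_⊎_; inj₁; inj₂)
open import Defs
open import Function using (_∘_; _on_)
open import Function.Bundles using (mk⇔; module Inverse; module Equivalence)
open import Function.Construct.Identity using (↔-id)
open import Level using (0ℓ)
open import Relation.Binary.Core using (Rel)
open import Relation.Binary.Definitions using (Symmetric; Irreflexive) renaming (Decidable to Decidable₂)
open import Relation.Binary.PropositionalEquality using (_≡_; _≢_; refl; sym; cong; cong₂; subst; setoid; module ≡-Reasoning) renaming (trans to ≡-trans)
open import Relation.Nullary using (¬_; yes; no; contradiction)
open import Relation.Nullary.Decidable using (¬?; _×-dec_; _⊎-dec_; _→-dec_; decidable-stable)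
open import Relation.Unary using (Pred; Decidable)

-- The numerical part compares two slopes in n. A vertex of low degree `j` carries fewer than (n +
-- k)/2 edges, while a vertex of T_r(n) carries about (1 - 1/r)n. Since the target is T_r(n - 1),
-- the loss of p + 1 low vertices is charged against only p Turán degrees, so p(1 - 1/r) has to
-- exceed (p + 1)/2, that is p(r - 2) > r. The choices are p = 5 for r = 3, p = 3 for 4 ≤ r ≤ 7 and
-- p = 2 for r ≥ 8; for p = 2 the surplus p(r - 2) - r is r - 4, the denominator in the last
-- hypothesis. With at most p low vertices the bound on `j` by n is replaced by j ≤ L + k, where L
-- is their number; a single vertex of degree k + 1 is the extremal case. Heaviness depends on
-- degrees, which grow as edges are added, so the pairs to add are not known in advance. The closure
-- is taken in rounds, and an arrangement is brought back through the rounds one at a time. A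
-- forbidden `j` found in the last round is forbidden for the original graph too, because added
-- edges only make low vertices rarer.

private variable
  A B : Set

-- Counting in lists and Turán's theorem

count : {P : Pred A 0ℓ} → Decidable P → List A → ℕ
count P? xs = length (filter P? xs)

module _ {P : Pred A 0ℓ} (P? : Decidable P) where

  count-accept : ∀ {x xs} → P x → count P? (x ∷ xs) ≡ suc (count P? xs)
  count-accept px = cong length (filter-accept P? px)

  count-reject : ∀ {x xs} → ¬ P x → count P? (x ∷ xs) ≡ count P? xs
  count-reject ¬px = cong length (filter-reject P? ¬px)

  count-++ : ∀ xs ys → count P? (xs ++ ys) ≡ count P? xs + count P? ys
  count-++ xs ys = ≡-trans (cong length (filter-++ P? xs ys)) (length-++ (filter P? xs))

  count-↭ : ∀ {xs ys} → xs ↭ ys → count P? xs ≡ count P? ys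
  count-↭ = ↭-length ∘ filter-↭ P?

  count≤length : ∀ xs → count P? xs ≤ length xs
  count≤length = length-filter P?

  count-none : ∀ {xs} → All (¬_ ∘ P) xs → count P? xs ≡ 0
  count-none = cong length ∘ filter-none P?

  count-∷-≤ : ∀ x xs → count P? xs ≤ count P? (x ∷ xs)
  count-∷-≤ x xs with P? x
  ... | yes _ = n≤1+n _
  ... | no  _ = ≤-refl

  count-∷-suc : ∀ x xs → count P? (x ∷ xs) ≤ suc (count P? xs)
  count-∷-suc x xs with P? x
  ... | yes _ = ≤-refl
  ... | no  _ = n≤1+n _

  count-map : (f : B → A) → ∀ xs → count P? (map f xs) ≡ count (P? ∘ f) xs
  count-map f [] = refl
  count-map f (x ∷ xs) with P? (f x)
  ... | yes _ = cong suc (count-map f xs)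
  ... | no  _ = count-map f xs

  count-complement : ∀ xs → count P? xs + count (¬? ∘ P?) xs ≡ length xs
  count-complement [] = refl
  count-complement (x ∷ xs) with P? x
  ... | yes _ = cong suc (count-complement xs)
  ... | no  _ = ≡-trans (+-suc _ _) (cong suc (count-complement xs))

  filter-↭-++ : ∀ xs → xs ↭ filter P? xs ++ filter (¬? ∘ P?) xs
  filter-↭-++ [] = ↭-refl
  filter-↭-++ (x ∷ xs) with P? x
  ... | yes _ = prep x (filter-↭-++ xs)
  ... | no  _ = ↭-trans (prep x (filter-↭-++ xs)) (↭-sym (shift x (filter P? xs) _))

module _ {P Q : Pred A 0ℓ} (P? : Decidable P) (Q? : Decidable Q) where

  count-mono : ∀ xs → (∀ {x} → x ∈ xs → P x → Q x) → count P? xs ≤ count Q? xs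
  count-mono [] P⊆Q = z≤n
  count-mono (x ∷ xs) P⊆Q with P? x | Q? x
  ... | yes px | yes _  = s≤s (count-mono xs (P⊆Q ∘ there))
  ... | yes px | no ¬qx = contradiction (P⊆Q (here refl) px) ¬qx
  ... | no  _  | yes _  = m≤n⇒m≤1+n (count-mono xs (P⊆Q ∘ there))
  ... | no  _  | no  _  = count-mono xs (P⊆Q ∘ there)

  count-mono-< : ∀ {y} xs → (∀ {x} → x ∈ xs → P x → Q x) →
                 y ∈ xs → ¬ P y → Q y → count P? xs < count Q? xs
  count-mono-< (x ∷ xs) P⊆Q y∈ ¬py qy with P? x | Q? x
  ... | yes px | yes _  with y∈
  ...   | here refl = contradiction px ¬py
  ...   | there y∈′ = s≤s (count-mono-< xs (P⊆Q ∘ there) y∈′ ¬py qy)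
  count-mono-< (x ∷ xs) P⊆Q y∈ ¬py qy | yes px | no ¬qx = contradiction (P⊆Q (here refl) px) ¬qx
  count-mono-< (x ∷ xs) P⊆Q y∈ ¬py qy | no _ | yes _ = s≤s (count-mono xs (P⊆Q ∘ there))
  count-mono-< (x ∷ xs) P⊆Q y∈ ¬py qy | no _ | no ¬qx with y∈
  ...   | here refl = contradiction qy ¬qx
  ...   | there y∈′ = count-mono-< xs (P⊆Q ∘ there) y∈′ ¬py qy

  count-filter-≤ : ∀ xs → count P? (filter Q? xs) ≤ count P? xs
  count-filter-≤ [] = z≤n
  count-filter-≤ (x ∷ xs) with Q? x
  ... | no  _ = ≤-trans (count-filter-≤ xs) (count-∷-≤ P? x xs)
  ... | yes _ with P? x
  ...   | yes _ = s≤s (count-filter-≤ xs)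
  ...   | no  _ = count-filter-≤ xs

module _ {P Q : Pred A 0ℓ} (P? : Decidable P) (Q? : Decidable Q) where

  -- If no element satisfied both predicates, the two counts would add up to at most the length, and
  -- to less because `y` satisfies neither. That exempt element is why equality in the bound already
  -- suffices.
  count-pigeonhole : ∀ {y} xs → y ∈ xs → ¬ P y → ¬ Q y → length xs ≤ count P? xs + count Q? xs →
                     ∃ λ x → x ∈ xs × P x × Q x
  count-pigeonhole {y} xs y∈ ¬py ¬qy bound with Any.any? (λ x → P? x ×-dec Q? x) xs
  ... | yes both = find both
  ... | no ¬both = contradiction bound (<⇒≱ (begin-strict
    count P? xs + count Q? xs        <⟨ +-monoˡ-< (count Q? xs) (count-mono-< P? (¬? ∘ Q?) xs P⊆¬Q y∈ ¬py ¬qy) ⟩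
    count (¬? ∘ Q?) xs + count Q? xs ≡⟨ +-comm (count (¬? ∘ Q?) xs) (count Q? xs) ⟩
    count Q? xs + count (¬? ∘ Q?) xs ≡⟨ count-complement Q? xs ⟩
    length xs                        ∎))
    where
    open ≤-Reasoning
    P⊆¬Q : ∀ {x} → x ∈ xs → P x → ¬ Q x
    P⊆¬Q x∈ px qx = ¬both (lose x∈ (px , qx))

module _ {R : Rel A 0ℓ} (R? : Decidable₂ R) where

  -- Edges are counted over a list of vertices, so that deleting vertices in an induction only
  -- splits the list and never renumbers a `Fin` type; for symmetric `R` the order is irrelevant by
  -- `edges-↭`.
  edges : List A → ℕ
  edges []       = 0
  edges (x ∷ xs) = count (R? x) xs + edges xs

  edges-++-≤ : ∀ {j} xs ys → All (λ x → count (R? x) (xs ++ ys) ≤ j) xs →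
               edges (xs ++ ys) ≤ length xs * j + edges ys
  edges-++-≤ [] ys [] = ≤-refl
  edges-++-≤ {j} (x ∷ xs) ys (dx ∷ ds) = begin
    count (R? x) (xs ++ ys) + edges (xs ++ ys)
      ≤⟨ +-mono-≤ (≤-trans (count-∷-≤ (R? x) x (xs ++ ys)) dx)
                  (edges-++-≤ xs ys (All.map (λ {y} → ≤-trans (count-∷-≤ (R? y) x (xs ++ ys))) ds)) ⟩
    j + (length xs * j + edges ys) ≡⟨ +-assoc j (length xs * j) (edges ys) ⟨
    j + length xs * j + edges ys   ∎
    where open ≤-Reasoning

  edges-swap : Symmetric R → ∀ x y xs → edges (x ∷ y ∷ xs) ≡ edges (y ∷ x ∷ xs)
  edges-swap symR x y xs with R? x y | R? y x
  ... | yes _  | yes _  = cong suc (x∙yz≈y∙xz +-commutativeSemigroup (count (R? x) xs) (count (R? y) xs) (edges xs))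
  ... | no _   | no _   = x∙yz≈y∙xz +-commutativeSemigroup (count (R? x) xs) (count (R? y) xs) (edges xs)
  ... | yes xy | no ¬yx = contradiction (symR xy) ¬yx
  ... | no ¬xy | yes yx = contradiction (symR yx) ¬xy

  edges-↭ : Symmetric R → ∀ {xs ys} → xs ↭ ys → edges xs ≡ edges ys
  edges-↭ symR refl          = refl
  edges-↭ symR (prep x p)    = cong₂ _+_ (count-↭ (R? x) p) (edges-↭ symR p)
  edges-↭ symR (trans p q)   = ≡-trans (edges-↭ symR p) (edges-↭ symR q)
  edges-↭ symR (swap {ys = ys} x y p) = ≡-trans
    (cong₂ _+_ (count-↭ (R? x) (prep y p)) (cong₂ _+_ (count-↭ (R? y) p) (edges-↭ symR p)))
    (edges-swap symR x y ys)

edges-map : {R : Rel B 0ℓ} (R? : Decidable₂ R) (f : A → B) → ∀ xs →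
            edges R? (map f xs) ≡ edges (λ x y → R? (f x) (f y)) xs
edges-map R? f []       = refl
edges-map R? f (x ∷ xs) = cong₂ _+_ (count-map (R? (f x)) f xs) (edges-map R? f xs)

edges-mono : {R S : Rel A 0ℓ} (R? : Decidable₂ R) (S? : Decidable₂ S) → (∀ {x y} → R x y → S x y) →
             ∀ xs → edges R? xs ≤ edges S? xs
edges-mono R? S? R⊆S []       = z≤n
edges-mono R? S? R⊆S (x ∷ xs) =
  +-mono-≤ (count-mono (R? x) (S? x) xs (λ _ → R⊆S)) (edges-mono R? S? R⊆S xs)

-- The recursion adds to T_r(n) a vertex of a smallest part, which has `n / r` vertices. Upper
-- bounds are proved for this number, and `turán≤e` transfers them to the graph.
turán : (r : ℕ) .{{_ : NonZero r}} → ℕ → ℕ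
turán r zero    = 0
turán r (suc n) = turán r n + (n ∸ n / r)

module _ {R : Rel A 0ℓ} (R? : Decidable₂ R) where

  private
    ¬R? : ∀ x → Decidable (¬_ ∘ R x)
    ¬R? x y = ¬? (R? x y)

  -- Each chosen vertex discards its non-neighbours, at most d / r of them, so `r * length xs` drops
  -- by at most `d` per choice. After `i` choices the list is still non-empty and yields one more
  -- vertex. Everything is multiplied by `r` to avoid division.
  greedyClique : ∀ {r d} i xs → All (λ x → r * count (¬R? x) xs ≤ d) xs → i * d < r * length xs →
                 ∃ λ c → length c ≡ suc i × AllPairs R c × All (_∈ xs) c
  greedyClique {r} i [] _ big = contradiction (≤-trans big (≤-reflexive (*-zeroʳ r))) λ ()
  greedyClique zero (x ∷ xs) _ _ = x ∷ [] , refl , [] ∷ [] , here refl ∷ []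
  greedyClique {r} {d} (suc i) xs@(x ∷ _) few@(few-x ∷ _) big =
    let c , len , cl , c⊆ = greedyClique {r} i xs′ few′ big′
    in  x ∷ c , cong suc len , All.map (proj₂ ∘ ∈-filter⁻ (R? x) {xs = xs}) c⊆ ∷ cl
              , here refl ∷ All.map (proj₁ ∘ ∈-filter⁻ (R? x)) c⊆
    where
    xs′ = filter (R? x) xs
    few′ : All (λ y → r * count (¬R? y) xs′ ≤ d) xs′
    few′ = All.tabulate λ {y} y∈ →
      ≤-trans (*-monoʳ-≤ r (count-filter-≤ (¬R? y) (R? x) xs))
              (All.lookup few (proj₁ (∈-filter⁻ (R? x) y∈)))
    big′ : i * d < r * length xs′
    big′ = +-cancelˡ-< d _ _ (begin-strict
      d + i * d                             <⟨ big ⟩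
      r * length xs                         ≡⟨ cong (r *_) (count-complement (R? x) xs) ⟨
      r * (length xs′ + count (¬R? x) xs)   ≡⟨ *-distribˡ-+ r (length xs′) _ ⟩
      r * length xs′ + r * count (¬R? x) xs ≤⟨ +-monoʳ-≤ (r * length xs′) few-x ⟩
      r * length xs′ + d                    ≡⟨ +-comm (r * length xs′) d ⟩
      d + r * length xs′                    ∎)
      where open ≤-Reasoning

  module _ (symR : Symmetric R) (r : ℕ) .{{_ : NonZero r}}
           (free : ∀ c → AllPairs R c → length c ≢ suc r) where

    -- Among n + 1 vertices, if all have at most n / r non-neighbours (each vertex counting itself),
    -- the greedy choice finds r + 1 pairwise adjacent ones. Otherwise some `x` has degree at most
    -- `n ∸ n / r`, exactly the increment in `turán`, and is removed.
    turán-bound : ∀ n xs → length xs ≡ n → edges R? xs ≤ turán r n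
    turán-bound zero    []       _ = z≤n
    turán-bound (suc n) xs len with Any.any? (λ x → n <? r * count (¬R? x) xs) xs
    ... | no none = contradiction len′ (free c cl)
      where
      found = greedyClique {r = r} {d = n} r xs
                (All.map ≮⇒≥ (¬Any⇒All¬ xs none))
                (subst (λ l → r * n < r * l) (sym len) (*-monoʳ-< r (n<1+n n)))
      c = proj₁ found
      len′ = proj₁ (proj₂ found)
      cl = proj₁ (proj₂ (proj₂ found))
    ... | yes some with find some
    ...   | x , x∈ , many with ∈-∃++ x∈
    ...     | ys , zs , refl = begin
      edges R? (ys ++ x ∷ zs)                            ≡⟨ edges-↭ R? symR (shift x ys zs) ⟩
      count (R? x) (ys ++ zs) + edges R? (ys ++ zs)      ≤⟨ +-mono-≤ deg (turán-bound n (ys ++ zs) len′) ⟩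
      (n ∸ n / r) + turán r n                            ≡⟨ +-comm (n ∸ n / r) _ ⟩
      turán r n + (n ∸ n / r)                            ∎
      where
      open ≤-Reasoning
      len′ : length (ys ++ zs) ≡ n
      len′ = suc-injective (≡-trans (sym (↭-length (shift x ys zs))) len)
      c = count (¬R? x) (ys ++ x ∷ zs)
      n/r<c : n / r < c
      n/r<c = m<n*o⇒m/o<n (≤-trans many (≤-reflexive (*-comm r c)))
      deg : count (R? x) (ys ++ zs) ≤ n ∸ n / r
      deg = m+n≤o⇒m≤o∸n _ (s≤s⁻¹ (begin
        suc (count (R? x) (ys ++ zs) + n / r)      ≡⟨ +-suc _ _ ⟨
        count (R? x) (ys ++ zs) + suc (n / r)      ≤⟨ +-mono-≤ (count-∷-≤ (R? x) x (ys ++ zs)) n/r<c ⟩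
        count (R? x) (x ∷ ys ++ zs) + c            ≡⟨ cong (_+ c) (count-↭ (R? x) (shift x ys zs)) ⟨
        count (R? x) (ys ++ x ∷ zs) + c            ≡⟨ count-complement (R? x) (ys ++ x ∷ zs) ⟩
        length (ys ++ x ∷ zs)                      ≡⟨ len ⟩
        suc n                                      ∎))

-- Walks and segment reversal

∷⇒∷ʳ : ∀ (x : A) xs → ∃₂ λ ys l → x ∷ xs ≡ ys ∷ʳ l
∷⇒∷ʳ x []       = [] , x , refl
∷⇒∷ʳ x (y ∷ xs) with ∷⇒∷ʳ y xs
... | ys , l , eq = x ∷ ys , l , cong (x ∷_) eq

steps-++ : ∀ (xs : List A) y zs → steps (xs ++ y ∷ zs) ≡ steps (xs ∷ʳ y) ++ steps (y ∷ zs)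
steps-++ []            y zs = refl
steps-++ (x ∷ [])      y zs = refl
steps-++ (x ∷ x′ ∷ xs) y zs = cong ((x , x′) ∷_) (steps-++ (x′ ∷ xs) y zs)

steps-reverse : ∀ (xs : List A) → steps (reverse xs) ≡ reverse (map swap× (steps xs))
steps-reverse []           = refl
steps-reverse (x ∷ [])     = refl
steps-reverse (x ∷ y ∷ zs) = begin
  steps (reverse (x ∷ y ∷ zs))                     ≡⟨ cong steps (unfold-reverse x (y ∷ zs)) ⟩
  steps (reverse (y ∷ zs) ∷ʳ x)                    ≡⟨ cong (λ l → steps (l ∷ʳ x)) (unfold-reverse y zs) ⟩
  steps ((reverse zs ∷ʳ y) ∷ʳ x)                   ≡⟨ cong steps (++-assoc (reverse zs) _ _) ⟩
  steps (reverse zs ++ y ∷ x ∷ [])                 ≡⟨ steps-++ (reverse zs) y (x ∷ []) ⟩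
  steps (reverse zs ∷ʳ y) ∷ʳ (y , x)               ≡⟨ cong (λ l → steps l ∷ʳ (y , x)) (unfold-reverse y zs) ⟨
  steps (reverse (y ∷ zs)) ∷ʳ (y , x)              ≡⟨ cong (_∷ʳ (y , x)) (steps-reverse (y ∷ zs)) ⟩
  reverse (map swap× (steps (y ∷ zs))) ∷ʳ (y , x)  ≡⟨ unfold-reverse (y , x) (map swap× (steps (y ∷ zs))) ⟨
  reverse (map swap× (steps (x ∷ y ∷ zs)))         ∎
  where open ≡-Reasoning

steps-firsts : ∀ (xs : List A) y → map proj₁ (steps (xs ∷ʳ y)) ≡ xs
steps-firsts []            y = refl
steps-firsts (x ∷ [])      y = refl
steps-firsts (x ∷ x′ ∷ xs) y = cong (x ∷_) (steps-firsts (x′ ∷ xs) y)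

steps-seconds : ∀ (x : A) xs → map proj₂ (steps (x ∷ xs)) ≡ xs
steps-seconds x []       = refl
steps-seconds x (y ∷ xs) = cong (y ∷_) (steps-seconds y xs)

∈-steps : ∀ {a b} (xs : List A) → (a , b) ∈ steps xs → ∃₂ λ ys zs → xs ≡ ys ++ a ∷ b ∷ zs
∈-steps (x ∷ y ∷ xs) (here refl) = [] , xs , refl
∈-steps (x ∷ y ∷ xs) (there ab∈) with ∈-steps (y ∷ xs) ab∈
... | ys , zs , eq = x ∷ ys , zs , cong (x ∷_) eq

Linked⇒All-steps : ∀ {R : Rel A 0ℓ} {xs} → Linked R xs → All (uncurry R) (steps xs)
Linked⇒All-steps []       = []
Linked⇒All-steps [-]      = []
Linked⇒All-steps (r ∷ rs) = r ∷ Linked⇒All-steps rs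

All-steps⇒Linked : ∀ {R : Rel A 0ℓ} xs → All (uncurry R) (steps xs) → Linked R xs
All-steps⇒Linked []           _        = []
All-steps⇒Linked (x ∷ [])     _        = [-]
All-steps⇒Linked (x ∷ y ∷ xs) (r ∷ rs) = r ∷ All-steps⇒Linked (y ∷ xs) rs

-- The two ends `h` and `l` of `S` are given by separate equations, so that the same formula serves
-- `S` and, with the ends exchanged, `reverse S`.
steps-around : ∀ (xs : List A) {x y ys S h S₁ S₂ l} → S ≡ h ∷ S₁ → S ≡ S₂ ∷ʳ l →
               steps (xs ++ x ∷ (S ++ y ∷ ys)) ≡
               steps (xs ∷ʳ x) ++ (x , h) ∷ (steps S ++ (l , y) ∷ steps (y ∷ ys))
steps-around xs {x} {y} {ys} {S} {h} {S₁} {S₂} {l} refl eq = begin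
  steps (xs ++ x ∷ (S ++ y ∷ ys))                                     ≡⟨ steps-++ xs x _ ⟩
  steps (xs ∷ʳ x) ++ (x , h) ∷ steps (S ++ y ∷ ys)                    ≡⟨ cong (λ m → steps (xs ∷ʳ x) ++ (x , h) ∷ m) mid ⟩
  steps (xs ∷ʳ x) ++ (x , h) ∷ (steps S ++ (l , y) ∷ steps (y ∷ ys))  ∎
  where
  open ≡-Reasoning
  mid : steps (S ++ y ∷ ys) ≡ steps S ++ (l , y) ∷ steps (y ∷ ys)
  mid = begin
    steps (S ++ y ∷ ys)                           ≡⟨ cong (λ m → steps (m ++ y ∷ ys)) eq ⟩
    steps ((S₂ ∷ʳ l) ++ y ∷ ys)                   ≡⟨ cong steps (++-assoc S₂ _ _) ⟩
    steps (S₂ ++ l ∷ y ∷ ys)                      ≡⟨ steps-++ S₂ l _ ⟩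
    steps (S₂ ∷ʳ l) ++ (l , y) ∷ steps (y ∷ ys)   ≡⟨ cong (λ m → steps m ++ (l , y) ∷ steps (y ∷ ys)) eq ⟨
    steps S ++ (l , y) ∷ steps (y ∷ ys)           ∎

reverse-segment-∷ʳ : ∀ {c : A} Q xs S y ys → Q ∷ʳ c ≡ xs ++ S ++ y ∷ ys →
                     ∃ λ Q′ → Q′ ↭ Q × Q′ ∷ʳ c ≡ xs ++ reverse S ++ y ∷ ys
reverse-segment-∷ʳ {c = c} Q xs S y ys eq =
  xs ++ reverse S ++ ys′ , perm , ≡-trans (sym last′) (cong (λ m → xs ++ reverse S ++ m) (sym eqys))
  where
  ys′ = proj₁ (∷⇒∷ʳ y ys)
  c′ = proj₁ (proj₂ (∷⇒∷ʳ y ys))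
  eqys = proj₂ (proj₂ (∷⇒∷ʳ y ys))
  assoc : ∀ T → xs ++ T ++ ys′ ∷ʳ c′ ≡ (xs ++ T ++ ys′) ∷ʳ c′
  assoc T = ≡-trans (cong (xs ++_) (sym (++-assoc T ys′ _))) (sym (++-assoc xs (T ++ ys′) _))
  inj : Q ≡ xs ++ S ++ ys′ × c ≡ c′
  inj = ∷ʳ-injective Q (xs ++ S ++ ys′) (≡-trans eq (≡-trans (cong (λ m → xs ++ S ++ m) eqys) (assoc S)))
  last′ : xs ++ reverse S ++ ys′ ∷ʳ c′ ≡ (xs ++ reverse S ++ ys′) ∷ʳ c
  last′ = ≡-trans (assoc (reverse S)) (cong ((xs ++ reverse S ++ ys′) ∷ʳ_) (sym (proj₂ inj)))
  perm : xs ++ reverse S ++ ys′ ↭ Q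
  perm = ↭-trans (++⁺ˡ xs (++⁺ʳ ys′ (↭-reverse S))) (↭-reflexive (sym (proj₁ inj)))

-- The segment lies strictly between `x` and `y`, so the ends `p` and `c`, to which the prescribed
-- path is attached, never move.
reverse-segment : ∀ {p c : A} Q xs x S y ys → p ∷ Q ∷ʳ c ≡ xs ++ x ∷ (S ++ y ∷ ys) →
                  ∃ λ Q′ → Q′ ↭ Q × p ∷ Q′ ∷ʳ c ≡ xs ++ x ∷ (reverse S ++ y ∷ ys)
reverse-segment Q [] x S y ys eq with ∷-injective eq
... | refl , eq′ with reverse-segment-∷ʳ Q [] S y ys eq′
...   | Q′ , Q′↭Q , eq″ = Q′ , Q′↭Q , cong (x ∷_) eq″
reverse-segment Q (x₀ ∷ xs) x S y ys eq with ∷-injective eq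
... | refl , eq′ with reverse-segment-∷ʳ Q (xs ∷ʳ x) S y ys (≡-trans eq′ (sym (++-assoc xs _ _)))
...   | Q′ , Q′↭Q , eq″ = Q′ , Q′↭Q , cong (x₀ ∷_) (≡-trans eq″ (++-assoc xs _ _))

nonEdge? : {R : Rel A 0ℓ} → Decidable₂ R → Decidable (¬_ ∘ uncurry R)
nonEdge? R? (x , y) = ¬? (R? x y)

gapCount : {R : Rel A 0ℓ} → Decidable₂ R → List A → ℕ
gapCount R? xs = count (nonEdge? R?) (steps xs)

module _ {R H : Rel A 0ℓ} (R? : Decidable₂ R)
         (symR : Symmetric R) (symH : Symmetric H) (R⊆H : ∀ {x y} → R x y → H x y) where

  private
    gap? = nonEdge? R?
    gaps = gapCount R?

  -- `H` is the enlarged graph, in which gaps of `R` are tolerated. The last component keeps every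
  -- step inside `H`, so the gaps that remain after a repair can be repaired in turn.
  Improvement : A → List A → A → Set
  Improvement p Q c = ∃ λ Q′ → Q′ ↭ Q × gaps (p ∷ Q′ ∷ʳ c) < gaps (p ∷ Q ∷ʳ c)
                               × (All (uncurry H) (steps (p ∷ Q ∷ʳ c)) → All (uncurry H) (steps (p ∷ Q′ ∷ʳ c)))

  gaps-reverse : ∀ xs → gaps (reverse xs) ≤ gaps xs
  gaps-reverse xs = begin
    count gap? (steps (reverse xs))                ≡⟨ cong (count gap?) (steps-reverse xs) ⟩
    count gap? (reverse (map swap× (steps xs)))    ≡⟨ count-↭ gap? (↭-reverse (map swap× (steps xs))) ⟩
    count gap? (map swap× (steps xs))              ≡⟨ count-map gap? swap× (steps xs) ⟩
    count (gap? ∘ swap×) (steps xs)                ≤⟨ count-mono (gap? ∘ swap×) gap? (steps xs) (λ _ ¬r r → ¬r (symR r)) ⟩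
    count gap? (steps xs)                          ∎
    where open ≤-Reasoning

  All-steps-reverse : ∀ xs → All (uncurry H) (steps xs) → All (uncurry H) (steps (reverse xs))
  All-steps-reverse xs hs = subst (All (uncurry H)) (sym (steps-reverse xs))
    (All-resp-↭ (↭-sym (↭-reverse (map swap× (steps xs)))) (All-map⁺ (All.map symH hs)))

  -- Reversing `S` trades the steps (x , h) and (l , y), of which at least one is a gap, for (x , l)
  -- and (h , y), which are edges of `R`. The steps inside `S` are merely turned around, which
  -- symmetry makes harmless.
  improve : ∀ {p c} Q xs {x y ys S h S₁ S₂ l} → S ≡ h ∷ S₁ → S ≡ S₂ ∷ʳ l →
            p ∷ Q ∷ʳ c ≡ xs ++ x ∷ (S ++ y ∷ ys) →
            ¬ R x h ⊎ ¬ R l y → R x l → R h y → Improvement p Q c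
  improve {p} {c} Q xs {x} {y} {ys} {S} {h} {S₁} {S₂} {l} front back eq gap xl hy =
    Q′ , Q′↭Q , fewer , all
    where
    rev = reverse-segment Q xs x S y ys eq
    Q′ = proj₁ rev
    Q′↭Q = proj₁ (proj₂ rev)
    pre = steps (xs ∷ʳ x)
    post = steps (y ∷ ys)
    old : steps (p ∷ Q ∷ʳ c) ≡ pre ++ (x , h) ∷ (steps S ++ (l , y) ∷ post)
    old = ≡-trans (cong steps eq) (steps-around xs front back)
    new : steps (p ∷ Q′ ∷ʳ c) ≡ pre ++ (x , l) ∷ (steps (reverse S) ++ (h , y) ∷ post)
    new = ≡-trans (cong steps (proj₂ (proj₂ rev)))
                  (steps-around xs (≡-trans (cong reverse back) (reverse-++ S₂ (l ∷ [])))
                                   (≡-trans (cong reverse front) (unfold-reverse h S₁)))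
    #old : ¬ R x h ⊎ ¬ R l y → suc (gaps S + count gap? post) ≤ count gap? ((x , h) ∷ (steps S ++ (l , y) ∷ post))
    #old (inj₁ ¬xh) = begin
      suc (gaps S + count gap? post)                         ≤⟨ s≤s (+-monoʳ-≤ (gaps S) (count-∷-≤ gap? (l , y) post)) ⟩
      suc (gaps S + count gap? ((l , y) ∷ post))             ≡⟨ cong suc (count-++ gap? (steps S) _) ⟨
      suc (count gap? (steps S ++ (l , y) ∷ post))           ≡⟨ count-accept gap? ¬xh ⟨
      count gap? ((x , h) ∷ (steps S ++ (l , y) ∷ post))     ∎
      where open ≤-Reasoning
    #old (inj₂ ¬ly) = begin
      suc (gaps S + count gap? post)                         ≡⟨ +-suc (gaps S) _ ⟨
      gaps S + suc (count gap? post)                         ≡⟨ cong (gaps S +_) (count-accept gap? ¬ly) ⟨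
      gaps S + count gap? ((l , y) ∷ post)                   ≡⟨ count-++ gap? (steps S) _ ⟨
      count gap? (steps S ++ (l , y) ∷ post)                 ≤⟨ count-∷-≤ gap? (x , h) _ ⟩
      count gap? ((x , h) ∷ (steps S ++ (l , y) ∷ post))     ∎
      where open ≤-Reasoning
    fewer : gaps (p ∷ Q′ ∷ʳ c) < gaps (p ∷ Q ∷ʳ c)
    fewer = begin-strict
      gaps (p ∷ Q′ ∷ʳ c)
        ≡⟨ cong (count gap?) new ⟩
      count gap? (pre ++ (x , l) ∷ (steps (reverse S) ++ (h , y) ∷ post))
        ≡⟨ count-++ gap? pre _ ⟩
      count gap? pre + count gap? ((x , l) ∷ (steps (reverse S) ++ (h , y) ∷ post))
        ≡⟨ cong (count gap? pre +_) (count-reject gap? (λ ¬r → ¬r xl)) ⟩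
      count gap? pre + count gap? (steps (reverse S) ++ (h , y) ∷ post)
        ≡⟨ cong (count gap? pre +_) (count-++ gap? (steps (reverse S)) _) ⟩
      count gap? pre + (gaps (reverse S) + count gap? ((h , y) ∷ post))
        ≡⟨ cong (λ m → count gap? pre + (gaps (reverse S) + m)) (count-reject gap? (λ ¬r → ¬r hy)) ⟩
      count gap? pre + (gaps (reverse S) + count gap? post)
        ≤⟨ +-monoʳ-≤ (count gap? pre) (+-monoˡ-≤ _ (gaps-reverse S)) ⟩
      count gap? pre + (gaps S + count gap? post)
        <⟨ +-monoʳ-< (count gap? pre) (#old gap) ⟩
      count gap? pre + count gap? ((x , h) ∷ (steps S ++ (l , y) ∷ post))
        ≡⟨ count-++ gap? pre _ ⟨
      count gap? (pre ++ (x , h) ∷ (steps S ++ (l , y) ∷ post))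
        ≡⟨ cong (count gap?) old ⟨
      gaps (p ∷ Q ∷ʳ c) ∎
      where open ≤-Reasoning
    all : All (uncurry H) (steps (p ∷ Q ∷ʳ c)) → All (uncurry H) (steps (p ∷ Q′ ∷ʳ c))
    all hs with All-++⁻ pre (subst (All (uncurry H)) old hs)
    ... | hpre , _ ∷ hrest with All-++⁻ (steps S) hrest
    ...   | hS , _ ∷ hpost = subst (All (uncurry H)) (sym new)
      (All-++⁺ hpre (R⊆H xl ∷ All-++⁺ (All-steps-reverse S hS) (R⊆H hy ∷ hpost)))

  -- The step (a , b) cannot be the gap itself, since `R` is irreflexive. If it comes before the
  -- gap, the segment from `b` to `u` is reversed; if after, the segment from `v` to `a`. Either way
  -- the new steps join `u` with `a` and `v` with `b`.
  exchange : Irreflexive _≡_ R → ∀ {p c u v a b} Q → (u , v) ∈ steps (p ∷ Q ∷ʳ c) → ¬ R u v →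
             (a , b) ∈ steps (p ∷ Q ∷ʳ c) → R u a → R v b → Improvement p Q c
  exchange irr {p} {c} {u} {v} {a} {b} Q uv∈ ¬uv ab∈ ua vb with ∈-steps (p ∷ Q ∷ʳ c) uv∈
  ... | X , Y , eq with ∈-++⁻ (steps (X ∷ʳ u)) (subst ((a , b) ∈_) (≡-trans (cong steps eq) (steps-++ X u (v ∷ Y))) ab∈)
  ...   | inj₂ (here refl) = contradiction ua (irr refl)
  ...   | inj₁ ab∈l with ∈-steps (X ∷ʳ u) ab∈l
  ...     | A′ , B′ , eql with ∷⇒∷ʳ b B′
  ...       | S₂ , l , eqS with ∷ʳ-injective X (A′ ++ a ∷ S₂)
                                  (≡-trans eql (≡-trans (cong (λ m → A′ ++ a ∷ m) eqS) (sym (++-assoc A′ (a ∷ S₂) (l ∷ [])))))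
  ...         | _ , refl = improve Q A′ refl eqS eq′ (inj₂ ¬uv) (symR ua) (symR vb)
    where
    eq′ : p ∷ Q ∷ʳ c ≡ A′ ++ a ∷ (b ∷ B′ ++ v ∷ Y)
    eq′ = begin
      p ∷ Q ∷ʳ c                      ≡⟨ eq ⟩
      X ++ u ∷ v ∷ Y                  ≡⟨ ++-assoc X (u ∷ []) (v ∷ Y) ⟨
      (X ∷ʳ u) ++ v ∷ Y               ≡⟨ cong (_++ v ∷ Y) eql ⟩
      (A′ ++ a ∷ b ∷ B′) ++ v ∷ Y     ≡⟨ ++-assoc A′ (a ∷ b ∷ B′) (v ∷ Y) ⟩
      A′ ++ a ∷ (b ∷ B′ ++ v ∷ Y)     ∎
      where open ≡-Reasoning
  exchange irr {p} {c} {u} {v} {a} {b} Q uv∈ ¬uv ab∈ ua vb | X , Y , eq | inj₂ (there ab∈r) with ∈-steps (v ∷ Y) ab∈r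
  ... | [] , B′ , refl = improve Q X {S₁ = []} {S₂ = []} refl refl eq (inj₁ ¬uv) ua vb
  ... | _ ∷ A′ , B′ , refl = improve Q X {S = v ∷ A′ ∷ʳ a} {S₂ = v ∷ A′} refl refl
    (≡-trans eq (cong (λ m → X ++ u ∷ v ∷ m) (sym (++-assoc A′ (a ∷ []) (b ∷ B′))))) (inj₁ ¬uv) ua vb

-- Heavy pairs

Unique-resp-↭ : ∀ {xs ys : List A} → xs ↭ ys → Unique xs → Unique ys
Unique-resp-↭ = Setoid↭.Unique-resp-↭ (setoid _) ∘ ↭⇒↭ₛ

AllPairs-++⁻ʳ : {R : Rel A 0ℓ} → ∀ xs {ys} → AllPairs R (xs ++ ys) → AllPairs R ys
AllPairs-++⁻ʳ []       rs       = rs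
AllPairs-++⁻ʳ (x ∷ xs) (_ ∷ rs) = AllPairs-++⁻ʳ xs rs

degreeOf : ∀ {n} {R : Rel (Fin n) 0ℓ} → Decidable₂ R → Fin n → ℕ
degreeOf {n} R? x = count (R? x) (allFin n)

-- The prescribed path runs from c to p and Z lists the remaining vertices; a Hamiltonian cycle
-- containing the path is closed by a walk p ∷ Q ∷ʳ c with Q ↭ Z.
module Extension {n k : ℕ} {p c : Fin n} {init tl Z : List (Fin n)}
  (split : c ∷ tl ≡ init ∷ʳ p) (perm : (c ∷ tl) ++ Z ↭ allFin n) (short : length tl ≤ k) where

  module _ {R : Rel (Fin n) 0ℓ} (R? : Decidable₂ R) (symR : Symmetric R) (irr : Irreflexive _≡_ R) where

    Heavy : Rel (Fin n) 0ℓ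
    Heavy x y = x ≢ y × n + k ≤ degreeOf R? x + degreeOf R? y

    heavy? : Decidable₂ Heavy
    heavy? x y = ¬? (x ≟ y) ×-dec (n + k ≤? degreeOf R? x + degreeOf R? y)

    Heavy-sym : Symmetric Heavy
    Heavy-sym {x} {y} (x≢y , h) = x≢y ∘ sym , subst (n + k ≤_) (+-comm (degreeOf R? x) _) h

    module _ {Q : List (Fin n)} (Q↭Z : Q ↭ Z) where

      perm′ : (c ∷ tl) ++ Q ↭ allFin n
      perm′ = ↭-trans (++⁺ˡ (c ∷ tl) Q↭Z) perm

      -- The vertices that start no step of `p ∷ Q ∷ʳ c` are those of the path other than `p`, and
      -- there are `length tl` of them. In `degree≤seconds` the vertices that end no step are those
      -- other than `c`.
      degree≤firsts : ∀ u → degreeOf R? u ≤ length tl + count (R? u) (p ∷ Q)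
      degree≤firsts u = begin
        degreeOf R? u                              ≡⟨ count-↭ (R? u) perm′ ⟨
        count (R? u) ((c ∷ tl) ++ Q)               ≡⟨ cong (λ l → count (R? u) (l ++ Q)) split ⟩
        count (R? u) ((init ∷ʳ p) ++ Q)            ≡⟨ cong (count (R? u)) (++-assoc init _ Q) ⟩
        count (R? u) (init ++ p ∷ Q)               ≡⟨ count-++ (R? u) init (p ∷ Q) ⟩
        count (R? u) init + count (R? u) (p ∷ Q)   ≤⟨ +-monoˡ-≤ _ (count≤length (R? u) init) ⟩
        length init + count (R? u) (p ∷ Q)         ≡⟨ cong (_+ count (R? u) (p ∷ Q)) len ⟩
        length tl + count (R? u) (p ∷ Q)           ∎
        where
        open ≤-Reasoning
        len : length init ≡ length tl
        len = suc-injective (≡-trans (sym (≡-trans (length-++ init) (+-comm (length init) 1))) (sym (cong length split)))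

      degree≤seconds : ∀ v → degreeOf R? v ≤ length tl + count (R? v) (Q ∷ʳ c)
      degree≤seconds v = begin
        degreeOf R? v                              ≡⟨ count-↭ (R? v) perm′ ⟨
        count (R? v) (c ∷ tl ++ Q)                 ≡⟨ count-↭ (R? v) (∷↭∷ʳ c (tl ++ Q)) ⟩
        count (R? v) ((tl ++ Q) ∷ʳ c)              ≡⟨ cong (count (R? v)) (++-assoc tl Q _) ⟩
        count (R? v) (tl ++ Q ∷ʳ c)                ≡⟨ count-++ (R? v) tl (Q ∷ʳ c) ⟩
        count (R? v) tl + count (R? v) (Q ∷ʳ c)    ≤⟨ +-monoˡ-≤ _ (count≤length (R? v) tl) ⟩
        length tl + count (R? v) (Q ∷ʳ c)          ∎
        where open ≤-Reasoning

      length-steps : length tl + length (steps (p ∷ Q ∷ʳ c)) ≡ n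
      length-steps = begin
        length tl + length (steps (p ∷ Q ∷ʳ c))              ≡⟨ cong (length tl +_) (length-map proj₁ (steps (p ∷ Q ∷ʳ c))) ⟨
        length tl + length (map proj₁ (steps (p ∷ Q ∷ʳ c)))  ≡⟨ cong (λ l → length tl + length l) (steps-firsts (p ∷ Q) c) ⟩
        length tl + suc (length Q)                           ≡⟨ +-suc (length tl) (length Q) ⟩
        suc (length tl + length Q)                           ≡⟨ cong suc (length-++ tl) ⟨
        length ((c ∷ tl) ++ Q)                               ≡⟨ ↭-length perm′ ⟩
        length (allFin n)                                    ≡⟨ length-tabulate (λ x → x) ⟩
        n                                                    ∎
        where open ≡-Reasoning

      -- This is the origin of the threshold n + k. The walk has n - `length tl` steps, and the path
      -- hides at most `length tl` ≤ k neighbours from each of `u` and `v`; so neighbours of `u`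
      -- that start a step and neighbours of `v` that end one together number at least the steps.
      -- The gap (u , v) counts for neither, hence some step counts for both.
      exchangeable : ∀ {u v} → (u , v) ∈ steps (p ∷ Q ∷ʳ c) → Heavy u v →
                     ∃ λ ab → ab ∈ steps (p ∷ Q ∷ʳ c) × R u (proj₁ ab) × R v (proj₂ ab)
      exchangeable {u} {v} uv∈ (_ , heavy) =
        count-pigeonhole (R? u ∘ proj₁) (R? v ∘ proj₂) S uv∈ (irr refl) (irr refl)
          (+-cancelˡ-≤ (length tl + length tl) _ _ (begin
            length tl + length tl + length S  ≡⟨ +-assoc (length tl) _ _ ⟩
            length tl + (length tl + length S) ≡⟨ cong (length tl +_) length-steps ⟩
            length tl + n                     ≤⟨ +-monoˡ-≤ n short ⟩
            k + n                             ≡⟨ +-comm k n ⟩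
            n + k                             ≤⟨ heavy ⟩
            degreeOf R? u + degreeOf R? v     ≤⟨ +-mono-≤ (degree≤firsts u) (degree≤seconds v) ⟩
            (length tl + count (R? u) (p ∷ Q)) + (length tl + count (R? v) (Q ∷ʳ c))
              ≡⟨ interchange +-commutativeSemigroup (length tl) _ (length tl) _ ⟩
            length tl + length tl + (count (R? u) (p ∷ Q) + count (R? v) (Q ∷ʳ c))
              ≡⟨ cong₂ (λ a b → length tl + length tl + (a + b)) firsts seconds ⟨
            length tl + length tl + (count (R? u ∘ proj₁) S + count (R? v ∘ proj₂) S) ∎))
        where
        open ≤-Reasoning
        S = steps (p ∷ Q ∷ʳ c)
        firsts : count (R? u ∘ proj₁) S ≡ count (R? u) (p ∷ Q)
        firsts = ≡-trans (sym (count-map (R? u) proj₁ S)) (cong (count (R? u)) (steps-firsts (p ∷ Q) c))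
        seconds : count (R? v ∘ proj₂) S ≡ count (R? v) (Q ∷ʳ c)
        seconds = ≡-trans (sym (count-map (R? v) proj₂ S)) (cong (count (R? v)) (steps-seconds p (Q ∷ʳ c)))

  Arrangement : Rel (Fin n) 0ℓ → Set
  Arrangement R = ∃ λ Q → Q ↭ Z × All (uncurry R) (steps (p ∷ Q ∷ʳ c))

  module _ {R : Rel (Fin n) 0ℓ} (R? : Decidable₂ R) (symR : Symmetric R) (irr : Irreflexive _≡_ R) where

    Closure : Rel (Fin n) 0ℓ
    Closure x y = R x y ⊎ Heavy R? symR irr x y

    closure? : Decidable₂ Closure
    closure? x y = R? x y ⊎-dec heavy? R? symR irr x y

    closure-sym : Symmetric Closure
    closure-sym (inj₁ r) = inj₁ (symR r)
    closure-sym (inj₂ h) = inj₂ (Heavy-sym R? symR irr h)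

    closure-irr : Irreflexive _≡_ Closure
    closure-irr eq (inj₁ r)         = irr eq r
    closure-irr eq (inj₂ (x≢y , _)) = x≢y eq

    -- `g` bounds the number of gaps and makes the recursion terminate. All steps stay in `Closure`,
    -- so every gap met is a heavy pair for the degrees of `R`.
    reduceGaps : ∀ g Q → Q ↭ Z → gapCount R? (p ∷ Q ∷ʳ c) ≤ g →
                 All (uncurry Closure) (steps (p ∷ Q ∷ʳ c)) → Arrangement R
    reduceGaps g Q Q↭Z ≤g hs with All.all? (λ (x , y) → R? x y) (steps (p ∷ Q ∷ʳ c))
    ... | yes rs = Q , Q↭Z , rs
    ... | no ¬rs with find (¬All⇒Any¬ (λ (x , y) → R? x y) _ ¬rs)
    ...   | (u , v) , uv∈ , ¬uv with All.lookup hs uv∈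
    ...     | inj₁ uv    = contradiction uv ¬uv
    ...     | inj₂ heavy with exchangeable R? symR irr Q↭Z uv∈ heavy
    ...       | _ , ab∈ , ua , vb with exchange R? symR closure-sym inj₁ irr Q uv∈ ¬uv ab∈ ua vb
    ...         | Q′ , Q′↭Q , fewer , keep with g | ≤-trans fewer ≤g
    ...           | suc g′ | s≤s ≤g′ = reduceGaps g′ Q′ (↭-trans Q′↭Q Q↭Z) ≤g′ (keep hs)

  unique : Unique (c ∷ tl ++ Z)
  unique = Unique-resp-↭ (↭-sym perm) (allFin⁺ n)

  unique-p∷Z : Unique (p ∷ Z)
  unique-p∷Z = AllPairs-++⁻ʳ init (subst Unique (≡-trans (cong (_++ Z) split) (++-assoc init _ Z)) unique)

  unique-Z∷ʳc : Unique (Z ∷ʳ c)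
  unique-Z∷ʳc = AllPairs-++⁻ʳ tl (subst Unique (++-assoc tl Z _)
    (Unique-resp-↭ (∷↭∷ʳ c (tl ++ Z)) unique))

  -- The path may be a single vertex, and then `p` and `c` coincide. Therefore distinctness is taken
  -- separately from `p ∷ Z` and `Z ∷ʳ c`, and a non-empty `Z` excludes a direct step from `p` to
  -- `c`.
  completeArrangement : {R : Rel (Fin n) 0ℓ} → (∀ x y → x ≢ y → R x y) → 0 < length Z → Arrangement R
  completeArrangement {R} total 0<Z = Z , ↭-refl , total-steps Z 0<Z unique-p∷Z unique-Z∷ʳc
    where
    total-steps : ∀ zs → 0 < length zs → Unique (p ∷ zs) → Unique (zs ∷ʳ c) → All (uncurry R) (steps (p ∷ zs ∷ʳ c))
    total-steps (z ∷ zs) _ ((p≢z ∷ _) ∷ _) u =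
      total _ _ p≢z ∷ All.map (total _ _) (Linked⇒All-steps (Linked.AllPairs⇒Linked u))

  -- Each round adds all currently heavy pairs and lowers the number of non-edges, which `m` bounds.
  -- When nothing is added, `complete` yields the complete graph, and `reduceGaps` undoes the rounds
  -- on the way back. `complete` speaks of every graph above `R₀` because the final one is unknown
  -- beforehand.
  extend : (R₀ : Rel (Fin n) 0ℓ) → 0 < length Z →
           (∀ {R} (R? : Decidable₂ R) → Symmetric R → Irreflexive _≡_ R → (∀ {x y} → R₀ x y → R x y) →
             (∀ x y → x ≢ y → ¬ R x y → degreeOf R? x + degreeOf R? y < n + k) → ∀ x y → x ≢ y → R x y) →
           ∀ m {R} (R? : Decidable₂ R) → Symmetric R → Irreflexive _≡_ R → (∀ {x y} → R₀ x y → R x y) →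
           count (nonEdge? R?) (cartesianProduct (allFin n) (allFin n)) < m → Arrangement R
  extend R₀ 0<Z complete (suc m) {R} R? symR irr ⊆R (s≤s ≤m)
    with any? (λ x → any? (λ y → heavy? R? symR irr x y ×-dec ¬? (R? x y)))
  ... | no none =
    completeArrangement (complete R? symR irr ⊆R (λ x y x≢y ¬xy → ≰⇒> λ h → none (x , y , (x≢y , h) , ¬xy))) 0<Z
  ... | yes (x , y , h , ¬xy) =
    let Q , Q↭Z , hs = extend R₀ 0<Z complete m (closure? R? symR irr) (closure-sym R? symR irr)
                         (closure-irr R? symR irr) (inj₁ ∘ ⊆R) (≤-trans fewer ≤m)
    in  reduceGaps R? symR irr _ Q Q↭Z ≤-refl hs
    where
    fewer : count (nonEdge? (closure? R? symR irr)) (cartesianProduct (allFin n) (allFin n)) <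
            count (nonEdge? R?) (cartesianProduct (allFin n) (allFin n))
    fewer = count-mono-< (nonEdge? (closure? R? symR irr)) (nonEdge? R?) (cartesianProduct (allFin n) (allFin n))
              (λ _ ¬c r → ¬c (inj₁ r)) (∈-cartesianProduct⁺ (∈-allFin x) (∈-allFin y)) (λ ¬c → ¬c (inj₂ h)) ¬xy

-- Low degrees and k-path Hamiltonicity

module _ {P Q S : Pred A 0ℓ} (P? : Decidable P) (Q? : Decidable Q) (S? : Decidable S) where

  count-⊎ : (∀ x → P x → Q x ⊎ S x) → ∀ xs → count P? xs ≤ count Q? xs + count S? xs
  count-⊎ P⊆ [] = z≤n
  count-⊎ P⊆ (x ∷ xs) with P? x
  ... | no _ = ≤-trans (count-⊎ P⊆ xs) (+-mono-≤ (count-∷-≤ Q? x xs) (count-∷-≤ S? x xs))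
  ... | yes px with P⊆ x px
  ...   | inj₁ qx = ≤-trans (s≤s (count-⊎ P⊆ xs)) (+-mono-≤ (≤-reflexive (sym (count-accept Q? qx))) (count-∷-≤ S? x xs))
  ...   | inj₂ sx = ≤-trans (≤-trans (s≤s (count-⊎ P⊆ xs)) (≤-reflexive (sym (+-suc _ _))))
                            (+-mono-≤ (count-∷-≤ Q? x xs) (≤-reflexive (sym (count-accept S? sx))))

count-positive : {P : Pred A 0ℓ} (P? : Decidable P) → ∀ {x xs} → x ∈ xs → P x → 0 < count P? xs
count-positive P? x∈ px = ∈-length (∈-filter⁺ P? x∈ px)

count-≟-unique : ∀ {n} (v : Fin n) {xs} → Unique xs → count (v ≟_) xs ≤ 1
count-≟-unique v [] = z≤n
count-≟-unique v {x ∷ xs} (x∉ ∷ u) with v ≟ x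
... | yes refl = s≤s (≤-reflexive (count-none (v ≟_) x∉))
... | no _     = count-≟-unique v u

maximal : (f : A → ℕ) {P : Pred A 0ℓ} (P? : Decidable P) → ∀ xs → Any P xs →
          ∃ λ m → P m × (∀ {y} → y ∈ xs → P y → f y ≤ f m)
maximal f P? (x ∷ xs) any with Any.any? P? xs
... | no none with any
...   | here px  = x , px , λ { (here refl) _ → ≤-refl ; (there y∈) py → contradiction (lose y∈ py) none }
...   | there p  = contradiction p none
maximal f P? (x ∷ xs) any | yes p with maximal f P? xs p
... | m , pm , max with P? x
...   | no ¬px = m , pm , λ { (here refl) py → contradiction py ¬px ; (there y∈) py → max y∈ py }
...   | yes px with ≤-total (f x) (f m)
...     | inj₁ x≤m = m , pm , λ { (here refl) _ → x≤m ; (there y∈) py → max y∈ py }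
...     | inj₂ m≤x = x , px , λ { (here refl) _ → ≤-refl ; (there y∈) py → ≤-trans (max y∈ py) m≤x }

unique-⇔⇒↭ : {xs ys : List A} → Unique xs → Unique ys →
              (∀ {x} → x ∈ xs → x ∈ ys) → (∀ {x} → x ∈ ys → x ∈ xs) → xs ↭ ys
unique-⇔⇒↭ ux uy to from = ∼bag⇒↭ (unique∧set⇒bag ux uy (mk⇔ to from))

module _ {n : ℕ} where

  module _ {R : Rel (Fin n) 0ℓ} (R? : Decidable₂ R) (symR : Symmetric R) where

    NonAdjacent : Rel (Fin n) 0ℓ
    NonAdjacent x y = x ≢ y × ¬ R x y

    nonAdjacent? : Decidable₂ NonAdjacent
    nonAdjacent? x y = ¬? (x ≟ y) ×-dec ¬? (R? x y)

    order≤ : ∀ v → n ≤ degreeOf R? v + suc (count (nonAdjacent? v) (allFin n))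
    order≤ v = begin
      n                                                              ≡⟨ length-tabulate (λ x → x) ⟨
      length (allFin n)                                              ≡⟨ count-complement (R? v) (allFin n) ⟨
      degreeOf R? v + count (¬? ∘ R? v) (allFin n)
        ≤⟨ +-monoʳ-≤ (degreeOf R? v) (count-⊎ _ (v ≟_) (nonAdjacent? v) cases (allFin n)) ⟩
      degreeOf R? v + (count (v ≟_) (allFin n) + count (nonAdjacent? v) (allFin n))
        ≤⟨ +-monoʳ-≤ (degreeOf R? v) (+-monoˡ-≤ _ (count-≟-unique v (allFin⁺ n))) ⟩
      degreeOf R? v + suc (count (nonAdjacent? v) (allFin n))        ∎
      where
      open ≤-Reasoning
      cases : ∀ x → ¬ R v x → v ≡ x ⊎ NonAdjacent v x
      cases x ¬vx with v ≟ x
      ... | yes v≡x = inj₁ v≡x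
      ... | no  v≢x = inj₂ (v≢x , ¬vx)

    -- This is Chvátal's choice: `v` has maximal degree among the vertices with a non-neighbour, and
    -- `u` maximal degree among the non-neighbours of `v`. The at least n - 1 - d(v) non-neighbours
    -- of `v` all have degree at most j = d(u), and d(v) + j < n + k turns their number into the
    -- last inequality. As `u` competed for the role of `v`, also j ≤ d(v), whence 2j < n + k.
    manyLowDegrees : ∀ {k} → (∀ x y → x ≢ y → ¬ R x y → degreeOf R? x + degreeOf R? y < n + k) →
                     ∀ {x y} → NonAdjacent x y →
                     ∃ λ j → j + j < n + k × 1 ≤ count (λ x → degreeOf R? x ≤? j) (allFin n)
                             × j ≤ count (λ x → degreeOf R? x ≤? j) (allFin n) + k
    manyLowDegrees {k} light {x} {y} x≁y
      with maximal (degreeOf R?) (λ x → any? (nonAdjacent? x)) (allFin n) (lose (∈-allFin x) (y , x≁y))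
    ... | v , (w , v≁w) , max-v
      with maximal (degreeOf R?) (nonAdjacent? v) (allFin n) (lose (∈-allFin w) v≁w)
    ...   | u , v≁u , max-u = j , j+j< , count-positive low? (∈-allFin u) ≤-refl , j≤
      where
      j = degreeOf R? u
      low? : Decidable (λ x → degreeOf R? x ≤ j)
      low? x = degreeOf R? x ≤? j
      j≤v : j ≤ degreeOf R? v
      j≤v = max-v (∈-allFin u) (v , proj₁ v≁u ∘ sym , proj₂ v≁u ∘ symR)
      v+u< : degreeOf R? v + j < n + k
      v+u< = light v u (proj₁ v≁u) (proj₂ v≁u)
      j+j< : j + j < n + k
      j+j< = ≤-trans (s≤s (+-monoˡ-≤ j j≤v)) v+u<
      low≥ : count (nonAdjacent? v) (allFin n) ≤ count low? (allFin n)
      low≥ = count-mono (nonAdjacent? v) low? (allFin n) max-u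
      j≤ : j ≤ count low? (allFin n) + k
      j≤ = +-cancelˡ-≤ (suc (degreeOf R? v)) _ _ (begin
        suc (degreeOf R? v) + j                                  ≤⟨ v+u< ⟩
        n + k                                                    ≤⟨ +-monoˡ-≤ k (order≤ v) ⟩
        degreeOf R? v + suc (count (nonAdjacent? v) (allFin n)) + k ≤⟨ +-monoˡ-≤ k (+-monoʳ-≤ (degreeOf R? v) (s≤s low≥)) ⟩
        degreeOf R? v + suc (count low? (allFin n)) + k          ≡⟨ cong (_+ k) (+-suc (degreeOf R? v) _) ⟩
        suc (degreeOf R? v) + count low? (allFin n) + k          ≡⟨ +-assoc (suc (degreeOf R? v)) _ k ⟩
        suc (degreeOf R? v) + (count low? (allFin n) + k)        ∎)
        where open ≤-Reasoning

  module _ (G : Graph n) where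

    lowDegreeCount : ℕ → ℕ
    lowDegreeCount j = count (λ x → degree G x ≤? j) (allFin n)

    chvátal : ∀ k → 3 ≤ n → suc k < n →
              (∀ j → j + j < n + k → 1 ≤ lowDegreeCount j → j ≤ lowDegreeCount j + k → ⊥) →
              k -PathHamiltonian G
    chvátal k 3≤n k+1<n sparse P len≤k = (cycle , spanning) , record
      { vertices⊆ = ∈-++⁺ˡ
      ; edges⊆    = λ ab∈ → inj₁ (subst (_ ∈_) (sym closed) (∈-++⁺ˡ ab∈))
      }
      where
      open Path P renaming (start to c; rest to tl)
      open import Data.List.Membership.DecPropositional (_≟_ {n}) using (_∈?_)
      last-split = ∷⇒∷ʳ c tl
      init = proj₁ last-split
      p = proj₁ (proj₂ last-split)
      split = proj₂ (proj₂ last-split)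
      Z = filter (¬? ∘ (_∈? walk)) (allFin n)
      walk↭ : filter (_∈? walk) (allFin n) ↭ walk
      walk↭ = unique-⇔⇒↭ (filter⁺ (_∈? walk) (allFin⁺ n)) distinct
                (proj₂ ∘ ∈-filter⁻ (_∈? walk) {xs = allFin n}) (λ x∈ → ∈-filter⁺ (_∈? walk) (∈-allFin _) x∈)
      perm : walk ++ Z ↭ allFin n
      perm = ↭-sym (↭-trans (filter-↭-++ (_∈? walk) (allFin n)) (++⁺ʳ Z walk↭))
      0<Z : 0 < length Z
      0<Z = +-cancelˡ-< (length walk) 0 (length Z) (begin-strict
        length walk + 0            ≡⟨ +-identityʳ _ ⟩
        suc (length tl)            ≤⟨ s≤s len≤k ⟩
        suc k                      <⟨ k+1<n ⟩
        n                          ≡⟨ length-tabulate (λ x → x) ⟨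
        length (allFin n)          ≡⟨ ↭-length perm ⟨
        length (walk ++ Z)         ≡⟨ length-++ walk ⟩
        length walk + length Z     ∎)
        where open ≤-Reasoning
      open Extension split perm len≤k
      complete : ∀ {R} (R? : Decidable₂ R) → Symmetric R → Irreflexive _≡_ R → (∀ {x y} → Adj G x y → R x y) →
                 (∀ x y → x ≢ y → ¬ R x y → degreeOf R? x + degreeOf R? y < n + k) → ∀ x y → x ≢ y → R x y
      complete R? symR irr ⊆R light x y x≢y with R? x y
      ... | yes xy = xy
      ... | no ¬xy =
        let j , j+j< , 1≤ , j≤ = manyLowDegrees R? symR {k} light {x} {y} (x≢y , ¬xy)
            -- Degrees in `R` are at least those in `G`, so the `j` found for `R` violates the
            -- hypothesis on `G` itself.
            fewer : count (λ x → degreeOf R? x ≤? j) (allFin n) ≤ lowDegreeCount j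
            fewer = count-mono (λ x → degreeOf R? x ≤? j) (λ x → degree G x ≤? j) (allFin n)
                      (λ {x} _ → ≤-trans (count-mono (adj? G x) (R? x) (allFin n) (λ _ → ⊆R)))
        in  ⊥-elim (sparse j j+j< (≤-trans 1≤ fewer) (≤-trans j≤ (+-monoˡ-≤ k fewer)))
      arrangement : Arrangement (Adj G)
      arrangement = extend (Adj G) 0<Z complete _ (adj? G) (symm G) (irrefl G) (λ r → r) ≤-refl
      Q = proj₁ arrangement
      perm″ : walk ++ Q ↭ allFin n
      perm″ = ↭-trans (++⁺ˡ walk (proj₁ (proj₂ arrangement))) perm
      closed : steps (c ∷ (tl ++ Q) ∷ʳ c) ≡ steps walk ++ steps (p ∷ Q ∷ʳ c)
      closed = begin
        steps (c ∷ (tl ++ Q) ∷ʳ c)                  ≡⟨ cong steps (++-assoc walk Q _) ⟩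
        steps (walk ++ Q ∷ʳ c)                      ≡⟨ cong (λ w → steps (w ++ Q ∷ʳ c)) split ⟩
        steps ((init ∷ʳ p) ++ Q ∷ʳ c)               ≡⟨ cong steps (++-assoc init _ _) ⟩
        steps (init ++ p ∷ Q ∷ʳ c)                  ≡⟨ steps-++ init p _ ⟩
        steps (init ∷ʳ p) ++ steps (p ∷ Q ∷ʳ c)     ≡⟨ cong (λ w → steps w ++ steps (p ∷ Q ∷ʳ c)) split ⟨
        steps walk ++ steps (p ∷ Q ∷ʳ c)            ∎
        where open ≡-Reasoning
      cycle : Cycle G
      cycle = record
        { start    = c
        ; rest     = tl ++ Q
        ; distinct = Unique-resp-↭ (↭-sym perm″) (allFin⁺ n)
        ; linked   = All-steps⇒Linked _ (subst (All (uncurry (Adj G))) (sym closed)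
                       (All-++⁺ (Linked⇒All-steps linked) (proj₂ (proj₂ arrangement))))
        ; ≥3       = subst (3 ≤_) (sym (≡-trans (↭-length perm″) (length-tabulate (λ x → x)))) 3≤n
        }
      spanning : ∀ v → v ∈ Cycle.vertices cycle
      spanning v = ∈-resp-↭ (↭-sym perm″) (∈-allFin v)

-- Edge counts of graphs and of the Turán graph

AllPairs-lookup : {R : Rel A 0ℓ} → Symmetric R → ∀ {xs} → AllPairs R xs →
                  ∀ i j → i ≢ j → R (lookup xs i) (lookup xs j)
AllPairs-lookup symR (rx ∷ rs) zero    zero    i≢j = contradiction refl i≢j
AllPairs-lookup symR (rx ∷ rs) zero    (suc j) i≢j = All.lookup rx (∈-lookup j)
AllPairs-lookup symR (rx ∷ rs) (suc i) zero    i≢j = symR (All.lookup rx (∈-lookup i))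
AllPairs-lookup symR (rx ∷ rs) (suc i) (suc j) i≢j = AllPairs-lookup symR rs i j (i≢j ∘ cong suc)

module _ {n : ℕ} (G : Graph n) where

  private
    later? : ∀ x → Decidable (λ y → x Fin.< y × Adj G x y)
    later? x y = (x Fin.<? y) ×-dec adj? G x y

  count-later : ∀ {x} zs xs → All (Fin._≤ x) zs → All (x Fin.<_) xs →
                count (later? x) (zs ++ xs) ≡ count (adj? G x) xs
  count-later {x} zs xs below above = begin
    count (later? x) (zs ++ xs)                      ≡⟨ count-++ (later? x) zs xs ⟩
    count (later? x) zs + count (later? x) xs
      ≡⟨ cong (_+ _) (count-none (later? x) (All.map (λ z≤x (x<z , _) → <⇒≱ x<z z≤x) below)) ⟩
    count (later? x) xs                              ≡⟨ ≤-antisym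
      (count-mono (later? x) (adj? G x) xs (λ _ → proj₂))
      (count-mono (adj? G x) (later? x) xs (λ y∈ a → All.lookup above y∈ , a)) ⟩
    count (adj? G x) xs                              ∎
    where open ≡-Reasoning

  -- `zs` collects the vertices whose rows have been dealt with. They remain as columns, but
  -- contribute nothing to later rows, since they precede all of `xs`.
  count-pairs : ∀ zs xs → AllPairs Fin._<_ xs → All (λ z → All (z Fin.<_) xs) zs →
                count (λ p → later? (proj₁ p) (proj₂ p)) (cartesianProduct xs (zs ++ xs)) ≡ edges (adj? G) xs
  count-pairs zs [] _ _ = refl
  count-pairs zs (x ∷ xs) (x< ∷ sorted) below = begin
    count pair? (map (x ,_) (zs ++ x ∷ xs) ++ cartesianProduct xs (zs ++ x ∷ xs))
      ≡⟨ count-++ pair? (map (x ,_) (zs ++ x ∷ xs)) _ ⟩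
    count pair? (map (x ,_) (zs ++ x ∷ xs)) + count pair? (cartesianProduct xs (zs ++ x ∷ xs))
      ≡⟨ cong₂ _+_ row rest ⟩
    count (adj? G x) xs + edges (adj? G) xs ∎
    where
    open ≡-Reasoning
    pair? : Decidable (λ (p : Fin n × Fin n) → proj₁ p Fin.< proj₂ p × Adj G (proj₁ p) (proj₂ p))
    pair? p = later? (proj₁ p) (proj₂ p)
    assoc : zs ++ x ∷ xs ≡ (zs ∷ʳ x) ++ xs
    assoc = sym (++-assoc zs (x ∷ []) xs)
    row : count pair? (map (x ,_) (zs ++ x ∷ xs)) ≡ count (adj? G x) xs
    row = ≡-trans (count-map pair? (x ,_) (zs ++ x ∷ xs))
          (≡-trans (cong (count (later? x)) assoc)
                   (count-later (zs ∷ʳ x) xs (All-++⁺ (All.map (<⇒≤ ∘ All.head) below) (≤-refl ∷ [])) x<))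
    rest : count pair? (cartesianProduct xs (zs ++ x ∷ xs)) ≡ edges (adj? G) xs
    rest = ≡-trans (cong (λ l → count pair? (cartesianProduct xs l)) assoc)
                   (count-pairs (zs ∷ʳ x) xs sorted (All-++⁺ (All.map All.tail below) (x< ∷ [])))

  e≡edges : e G ≡ edges (adj? G) (allFin n)
  e≡edges = count-pairs [] (allFin n) (AllPairs-tabulate⁺-< (λ i<j → i<j)) []

  clique⇒↪ : ∀ {c} → AllPairs (Adj G) c → K (length c) ↪ G
  clique⇒↪ {c} cl = record
    { emb       = lookup c
    ; injective = λ {i} {j} eq → decidable-stable (i ≟ j) (λ i≢j → irrefl G eq (AllPairs-lookup (symm G) cl i j i≢j))
    ; preserves = AllPairs-lookup (symm G) cl
    }

  e-deleteLow : ∀ {j} q r .{{_ : NonZero r}} → K (suc r) Free G → q ≤ lowDegreeCount G j →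
                e G ≤ q * j + turán r (n ∸ q)
  e-deleteLow {j} q r free q≤ = begin
    e G                                              ≡⟨ e≡edges ⟩
    edges (adj? G) (allFin n)                        ≡⟨ edges-↭ (adj? G) (symm G) perm ⟩
    edges (adj? G) (S ++ M)                          ≤⟨ edges-++-≤ (adj? G) S M low ⟩
    length S * j + edges (adj? G) M
      ≤⟨ +-mono-≤ (≤-reflexive (cong (_* j) lenS))
                  (turán-bound (adj? G) (symm G) r noClique (n ∸ q) M lenM) ⟩
    q * j + turán r (n ∸ q)                          ∎
    where
    open ≤-Reasoning
    low? : Decidable (λ x → degree G x ≤ j)
    low? x = degree G x ≤? j
    L = filter low? (allFin n)
    S = take q L
    M = drop q L ++ filter (¬? ∘ low?) (allFin n)
    perm : allFin n ↭ S ++ M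
    perm = ↭-trans (filter-↭-++ low? (allFin n)) (↭-reflexive
      (≡-trans (cong (_++ filter (¬? ∘ low?) (allFin n)) (sym (take++drop≡id q L))) (++-assoc S (drop q L) _)))
    lenS : length S ≡ q
    lenS = ≡-trans (length-take q L) (m≤n⇒m⊓n≡m q≤)
    lenM : length M ≡ n ∸ q
    lenM = ≡-trans (sym (m+n∸m≡n q (length M))) (cong (_∸ q) (≡-trans (cong (_+ length M) (sym lenS))
      (≡-trans (sym (length-++ S)) (≡-trans (sym (↭-length perm)) (length-tabulate (λ x → x))))))
    low : All (λ x → count (adj? G x) (S ++ M) ≤ j) S
    low = All.tabulate λ {x} x∈ → ≤-trans (≤-reflexive (sym (count-↭ (adj? G x) perm)))
      (proj₂ (∈-filter⁻ low? {xs = allFin n} (subst (x ∈_) (take++drop≡id q L) (∈-++⁺ˡ x∈))))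
    noClique : ∀ c → AllPairs (Adj G) c → length c ≢ suc r
    noClique c cl len = free (subst (λ m → K m ↪ G) len (clique⇒↪ cl))

tabulate-toℕ : (f : ℕ → A) → ∀ n → tabulate {n = n} (f ∘ toℕ) ≡ applyUpTo f n
tabulate-toℕ f zero    = refl
tabulate-toℕ f (suc n) = cong (f 0 ∷_) (tabulate-toℕ (f ∘ suc) n)

map-toℕ-allFin : ∀ n → map toℕ (allFin n) ≡ upTo n
map-toℕ-allFin n = ≡-trans (map-tabulate (λ i → i) toℕ) (tabulate-toℕ (λ i → i) n)

module _ (r : ℕ) .{{_ : NonZero r}} where

  %-shift-≢ : ∀ a s → s < r → 0 < a → a < r → (a + s) % r ≢ s
  %-shift-≢ a s s<r 0<a a<r eq with a + s <? r
  ... | yes lt = contradiction (≡-trans (sym (m<n⇒m%n≡m lt)) eq) (>⇒≢ (+-monoˡ-< s 0<a))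
  ... | no ≥r  = contradiction (+-cancelʳ-≡ s a r a+s≡r+s) (<⇒≢ a<r)
    where
    r≤ : r ≤ a + s
    r≤ = ≮⇒≥ ≥r
    lt : a + s ∸ r < r
    lt = +-cancelʳ-< r (a + s ∸ r) r (subst (_< r + r) (sym (m∸n+n≡m r≤)) (+-mono-< a<r s<r))
    a+s≡r+s : a + s ≡ r + s
    a+s≡r+s = ≡-trans (sym (m+[n∸m]≡n r≤)) (cong (r +_)
      (≡-trans (sym (m<n⇒m%n≡m lt)) (≡-trans (m≤n⇒[n∸m]%m≡n%m r≤) eq)))

  %-shift : ∀ a n → 0 < a → a < r → (a + n) % r ≢ n % r
  %-shift a n 0<a a<r eq = %-shift-≢ a (n % r) (m%n<n n r) 0<a a<r (begin
    (a + n % r) % r                    ≡⟨ [m+kn]%n≡m%n (a + n % r) (n / r) r ⟨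
    (a + n % r + n / r * r) % r        ≡⟨ cong (_% r) (+-assoc a _ _) ⟩
    (a + (n % r + n / r * r)) % r      ≡⟨ cong (λ m → (a + m) % r) (m≡m%n+[m/n]*n n r) ⟨
    (a + n) % r                        ≡⟨ eq ⟩
    n % r                              ∎)
    where open ≡-Reasoning

  residue? : ∀ s → Decidable (λ i → i % r ≡ s)
  residue? s i = i % r ℕ.≟ s

  count-residue-window : ∀ b d → d < r →
    count (residue? (b % r)) (downFrom (suc d + b)) ≤ suc (count (residue? (b % r)) (downFrom b))
  count-residue-window b zero    d<r = count-∷-suc (residue? (b % r)) b (downFrom b)
  count-residue-window b (suc d) d<r = ≤-trans
    (≤-reflexive (count-reject (residue? (b % r)) (%-shift (suc d) b z<s d<r)))
    (count-residue-window b d (<-trans (n<1+n d) d<r))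

  -- The induction strips the top window of `r` consecutive numbers. It starts at `s + q * r`, the
  -- only member of the class in that window.
  count-residue : ∀ q s → s < r → count (residue? s) (downFrom (s + q * r)) ≤ q
  count-residue zero s s<r = ≤-reflexive (count-none (residue? s) (All.tabulate λ {i} i∈ eq →
    let i<s = subst (i <_) (+-identityʳ s) (∈-downFrom⁻ i∈) in
    <⇒≢ i<s (≡-trans (sym (m<n⇒m%n≡m (<-trans i<s s<r))) eq)))
  count-residue (suc q) s s<r = begin
    count (residue? s) (downFrom (s + (r + q * r)))
      ≡⟨ cong₂ (λ t n → count (residue? t) (downFrom n)) (sym b%r) rearrange ⟩
    count (residue? (b % r)) (downFrom (suc (pred r) + b))
      ≤⟨ count-residue-window b (pred r) (≤-reflexive (suc-pred r)) ⟩
    suc (count (residue? (b % r)) (downFrom b))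
      ≡⟨ cong (λ t → suc (count (residue? t) (downFrom b))) b%r ⟩
    suc (count (residue? s) (downFrom b))
      ≤⟨ s≤s (count-residue q s s<r) ⟩
    suc q ∎
    where
    open ≤-Reasoning
    b = s + q * r
    b%r : b % r ≡ s
    b%r = ≡-trans ([m+kn]%n≡m%n s q r) (m<n⇒m%n≡m s<r)
    rearrange : s + (r + q * r) ≡ suc (pred r) + b
    rearrange = ≡-trans (x∙yz≈y∙xz +-commutativeSemigroup s r (q * r)) (cong (_+ b) (sym (suc-pred r)))

  distinctPart? : Decidable₂ (λ i j → i mod r ≢ j mod r)
  distinctPart? i j = ¬? ((i mod r) ≟ (j mod r))

  toℕ-mod : ∀ i → toℕ (i mod r) ≡ i % r
  toℕ-mod i = toℕ-fromℕ< (m%n<n i r)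

  -- Since n = n % r + (n / r) * r, the class of `n` has at most `n / r` members below `n` by
  -- `count-residue`. This feeds both the edge count of T_r(n) and the existence of extremal graphs.
  count-distinctPart : ∀ n → n ∸ n / r ≤ count (distinctPart? n) (downFrom n)
  count-distinctPart n = m≤n+o⇒m∸n≤o n (n / r) (begin
    n                                                          ≡⟨ length-downFrom n ⟨
    length (downFrom n)                                        ≡⟨ count-complement (distinctPart? n) (downFrom n) ⟨
    count (distinctPart? n) (downFrom n) + count (¬? ∘ distinctPart? n) (downFrom n)
      ≤⟨ +-monoʳ-≤ _ (count-mono (¬? ∘ distinctPart? n) (residue? (n % r)) (downFrom n) (λ {i} _ → same i)) ⟩
    count (distinctPart? n) (downFrom n) + count (residue? (n % r)) (downFrom n)
      ≡⟨ cong (λ m → count (distinctPart? n) (downFrom n) + count (residue? (n % r)) (downFrom m)) (m≡m%n+[m/n]*n n r) ⟩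
    count (distinctPart? n) (downFrom n) + count (residue? (n % r)) (downFrom (n % r + n / r * r))
      ≤⟨ +-monoʳ-≤ _ (count-residue (n / r) (n % r) (m%n<n n r)) ⟩
    count (distinctPart? n) (downFrom n) + n / r               ≡⟨ +-comm _ (n / r) ⟩
    n / r + count (distinctPart? n) (downFrom n)               ∎)
    where
    open ≤-Reasoning
    same : ∀ i → ¬ (n mod r ≢ i mod r) → i % r ≡ n % r
    same i ¬≢ = ≡-trans (sym (toℕ-mod i))
      (≡-trans (cong toℕ (sym (decidable-stable ((n mod r) ≟ (i mod r)) ¬≢))) (toℕ-mod n))

  turán≤edges : ∀ n → turán r n ≤ edges distinctPart? (downFrom n)
  turán≤edges zero    = z≤n
  turán≤edges (suc n) = ≤-trans (+-mono-≤ (turán≤edges n) (count-distinctPart n))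
                                (≤-reflexive (+-comm (edges distinctPart? (downFrom n)) _))

  turán≤e : ∀ n → turán r n ≤ e (T r n)
  turán≤e n = begin
    turán r n                                          ≤⟨ turán≤edges n ⟩
    edges distinctPart? (downFrom n)                   ≡⟨ cong (edges distinctPart?) (reverse-upTo n) ⟨
    edges distinctPart? (reverse (upTo n))             ≡⟨ edges-↭ distinctPart? (λ i≢j → i≢j ∘ sym) (↭-reverse (upTo n)) ⟩
    edges distinctPart? (upTo n)                       ≡⟨ cong (edges distinctPart?) (map-toℕ-allFin n) ⟨
    edges distinctPart? (map toℕ (allFin n))           ≡⟨ edges-map distinctPart? toℕ (allFin n) ⟩
    edges (adj? (T r n)) (allFin n)                    ≡⟨ e≡edges (T r n) ⟨
    e (T r n)                                          ∎
    where open ≤-Reasoning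

-- The choice of the number of deleted vertices

-- The identity exhibits R − L as Y − X plus a slack, which a ring solver can verify.
≤-certificate : ∀ {X Y L R} slack → X ≤ Y → L + Y + slack ≡ R + X → L ≤ R
≤-certificate {X} {Y} {L} {R} slack X≤Y eq = +-cancelʳ-≤ Y L R (begin
  L + Y          ≤⟨ m≤m+n (L + Y) slack ⟩
  L + Y + slack  ≡⟨ eq ⟩
  R + X          ≤⟨ +-monoʳ-≤ R X≤Y ⟩
  R + Y          ∎)
  where open ≤-Reasoning

module _ (r′ : ℕ) where

  private
    r = suc r′
    t = turán r
    D : ℕ → ℕ
    D i = i ∸ i / r

  -- Ignoring the rounding in `i / r` costs less than 1 per vertex and leaves polynomial estimates.
  turánDegree≥ : ∀ i → r′ * i ≤ r * D i
  turánDegree≥ i = begin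
    r′ * i                ≡⟨ m+n∸m≡n i (r′ * i) ⟨
    r * i ∸ i             ≤⟨ ∸-monoʳ-≤ (r * i) (≤-trans (≤-reflexive (*-comm r (i / r))) (m/n*n≤m i r)) ⟩
    r * i ∸ r * (i / r)   ≡⟨ *-distribˡ-∸ r i (i / r) ⟨
    r * D i               ∎
    where open ≤-Reasoning

  turán-growth : ∀ b {c} p → r * c ≤ r′ * b → t b + p * c ≤ t (p + b)
  turán-growth b zero    c≤ = ≤-reflexive (+-identityʳ (t b))
  turán-growth b {c} (suc p) c≤ = begin
    t b + (c + p * c)      ≡⟨ cong (t b +_) (+-comm c (p * c)) ⟩
    t b + (p * c + c)      ≡⟨ +-assoc (t b) (p * c) c ⟨
    t b + p * c + c        ≤⟨ +-mono-≤ (turán-growth b p c≤) c≤D ⟩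
    t (p + b) + D (p + b)  ∎
    where
    open ≤-Reasoning
    c≤D : c ≤ D (p + b)
    c≤D = *-cancelˡ-≤ r (≤-trans c≤ (≤-trans (*-monoʳ-≤ r′ (m≤n+m b p)) (turánDegree≥ (p + b))))

  rangeSum : ℕ → ℕ → ℕ
  rangeSum b zero    = 0
  rangeSum b (suc p) = rangeSum b p + (p + b)

  -- Unlike `turán-growth`, this keeps the increase of the degrees from vertex to vertex. It serves
  -- the case of p + 1 low vertices, where the estimates can be tight: for r = 3 the slack is 0.
  turán-rangeSum : ∀ b p → r * t b + r′ * rangeSum b p ≤ r * t (p + b)
  turán-rangeSum b zero    = ≤-reflexive (≡-trans (cong (r * t b +_) (*-zeroʳ r′)) (+-identityʳ _))
  turán-rangeSum b (suc p) = begin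
    r * t b + r′ * (rangeSum b p + (p + b))              ≡⟨ cong (r * t b +_) (*-distribˡ-+ r′ (rangeSum b p) (p + b)) ⟩
    r * t b + (r′ * rangeSum b p + r′ * (p + b))         ≡⟨ +-assoc (r * t b) _ _ ⟨
    r * t b + r′ * rangeSum b p + r′ * (p + b)           ≤⟨ +-mono-≤ (turán-rangeSum b p) (turánDegree≥ (p + b)) ⟩
    r * t (p + b) + r * D (p + b)                        ≡⟨ *-distribˡ-+ r (t (p + b)) (D (p + b)) ⟨
    r * t (suc p + b)                                    ∎
    where open ≤-Reasoning

  -- Since (p + 1)(p + 1 + k) = p(p + k + 2) + (k + 1), it suffices that each of the `p` Turán
  -- degrees is at least p + k + 2; what is left over is exactly the permitted k + 1. For p = 0
  -- nothing has to be compared.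
  fewDeleted : ∀ k b p {j} → j ≤ suc p + k → p ≡ 0 ⊎ r * (p + k + 2) ≤ r′ * b →
               suc p * j + t b ≤ t (p + b) + (k + 1)
  fewDeleted k b p {j} j≤ (inj₂ c≤) = begin
    suc p * j + t b                        ≤⟨ +-monoˡ-≤ (t b) (*-monoʳ-≤ (suc p) j≤) ⟩
    suc p * (suc p + k) + t b              ≡⟨ identity p k (t b) ⟩
    t b + p * (p + k + 2) + (k + 1)        ≤⟨ +-monoˡ-≤ (k + 1) (turán-growth b p c≤) ⟩
    t (p + b) + (k + 1)                    ∎
    where
    open ≤-Reasoning
    identity : ∀ p k x → suc p * (suc p + k) + x ≡ x + p * (p + k + 2) + (k + 1)
    identity = solve-∀
  fewDeleted k b zero {j} j≤ (inj₁ _) = begin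
    j + 0 + t b      ≡⟨ +-comm (j + 0) (t b) ⟩
    t b + (j + 0)    ≤⟨ +-monoʳ-≤ (t b) (≤-trans (≤-reflexive (+-identityʳ j)) (≤-trans j≤ (≤-reflexive (+-comm 1 k)))) ⟩
    t b + (k + 1)    ∎
    where open ≤-Reasoning

-- `L` stands for the number of vertices of degree at most `j`.
Deletion : (n r k : ℕ) .{{_ : NonZero r}} → ℕ → ℕ → Set
Deletion n r k L j = ∃ λ q → q ≤ L × q * j + turán r (n ∸ q) ≤ turán r (n ∸ 1) + (k + 1)

module _ (r′ k : ℕ) where

  private
    r = suc r′
    t = turán r

  -- Delete p + 1 vertices if there are that many of low degree, and otherwise all of them.
  chooseDeletion : ∀ n p {L j} → p < n → 1 ≤ L → j ≤ L + k →
    (∀ b i → n ≡ suc (suc i) + b → suc i < p → r * (suc i + k + 2) ≤ r′ * b) →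
    (∀ b → n ≡ p + suc b → suc p * j + t b ≤ t (p + b) + (k + 1)) →
    Deletion n r k L j
  chooseDeletion n p {L} {j} p<n 1≤L j≤ small big with p <? L
  ... | yes p<L = suc p , p<L , subst (λ y → suc p * j + t (n ∸ suc p) ≤ t y + (k + 1)) eq
    (big (n ∸ suc p) (≡-trans (sym (m+[n∸m]≡n p<n)) (sym (+-suc p _))))
    where eq : p + (n ∸ suc p) ≡ n ∸ 1
          eq = cong (_∸ 1) (m+[n∸m]≡n p<n)
  chooseDeletion n p {suc zero} {j} p<n 1≤L j≤ small big | no p≮L =
    1 , ≤-refl , fewDeleted r′ k (n ∸ 1) 0 j≤ (inj₁ refl)
  chooseDeletion n p {suc (suc i)} {j} p<n 1≤L j≤ small big | no p≮L =
    suc (suc i) , ≤-refl , subst (λ y → suc (suc i) * j + t (n ∸ suc (suc i)) ≤ t y + (k + 1)) (cong (_∸ 1) eq)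
      (fewDeleted r′ k (n ∸ suc (suc i)) (suc i) j≤ (inj₂ (small (n ∸ suc (suc i)) i (sym eq) (≮⇒≥ p≮L))))
    where eq : suc (suc i) + (n ∸ suc (suc i)) ≡ n
          eq = m+[n∸m]≡n (≤-trans (≮⇒≥ p≮L) (<⇒≤ p<n))

-- Six low vertices lose at most 3(n + k - 1) edges, while five Turán degrees for r = 3 amount to
-- about 10n/3. The surplus n/3 has to pay for the constants and the terms in k.
deletion-3 : ∀ n k {L j} → 6 * k + 26 ≤ n → j + j < n + k → 1 ≤ L → j ≤ L + k → Deletion n 3 k L j
deletion-3 n k {L} {j} n≥ j< 1≤L j≤ =
  chooseDeletion 2 k n 5 (≤-trans (≤-trans (m≤m+n 6 20) (m≤n+m 26 (6 * k))) n≥) 1≤L j≤ small big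
  where
  small : ∀ b i → n ≡ suc (suc i) + b → suc i < 5 → 3 * (suc i + k + 2) ≤ 2 * b
  small b i refl i< = ≤-certificate (9 * k + 24) (+-mono-≤ (*-monoʳ-≤ 2 n≥) (*-monoʳ-≤ 5 i<)) (identity b i k)
    where
    identity : ∀ b i k → 3 * (suc i + k + 2) + (2 * (suc (suc i) + b) + 25) + (9 * k + 24) ≡
                         2 * b + (2 * (6 * k + 26) + 5 * suc (suc i))
    identity = solve-∀
  big : ∀ b → n ≡ 5 + suc b → 6 * j + turán 3 b ≤ turán 3 (5 + b) + (k + 1)
  -- Comparing strictly with the successor before cancelling 3 uses integrality and gains 2. Without
  -- it the same certificate would need 6k + 28.
  big b refl = s≤s⁻¹ (*-cancelˡ-< 3 _ _ (≤-certificate 0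
    (+-mono-≤ (+-mono-≤ (*-monoʳ-≤ 9 j<) n≥) (turán-rangeSum 2 b 5)) (identity j b k (turán 3 b) (turán 3 (5 + b)))))
    where
    identity : ∀ j b k x y →
      suc (3 * (6 * j + x)) + (9 * (6 + b + k) + (6 + b) + 3 * y) + 0 ≡
      3 * suc (y + (k + 1)) + (9 * suc (j + j) + (6 * k + 26) +
        (3 * x + 2 * (0 + b + suc b + suc (suc b) + suc (suc (suc b)) + suc (suc (suc (suc b))))))
    identity = solve-∀

-- Four low vertices lose at most 2(n + k - 1) edges, while three Turán degrees amount to about 3(r
-- - 1)n/r. The surplus (r - 3)n/r explains the factor given to the bound on n: `2 + d` when r = 5 +
-- d, and 1 when r = 4.
deletion-4+ : ∀ n d k {L j} → 5 * k + 11 ≤ n → j + j < n + k → 1 ≤ L → j ≤ L + k → Deletion n (4 + d) k L j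
deletion-4+ n d k {L} {j} n≥ j< 1≤L j≤ =
  chooseDeletion (3 + d) k n 3 (≤-trans (≤-trans (m≤m+n 4 7) (m≤n+m 11 (5 * k))) n≥) 1≤L j≤ small (big d k n≥ j<)
  where
  small : ∀ b i → n ≡ suc (suc i) + b → suc i < 3 → (4 + d) * (suc i + k + 2) ≤ (3 + d) * b
  small b i refl i< = ≤-certificate (11 * k + 8 + d * (4 * k + 4))
    (+-mono-≤ (*-monoʳ-≤ (3 + d) n≥) (*-monoʳ-≤ (7 + (d + d)) i<)) (identity b i k d)
    where
    identity : ∀ b i k d →
      (4 + d) * (suc i + k + 2) + ((3 + d) * (suc (suc i) + b) + (7 + (d + d)) * 3) + (11 * k + 8 + d * (4 * k + 4)) ≡
      (3 + d) * b + ((3 + d) * (5 * k + 11) + (7 + (d + d)) * suc (suc i))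
    identity = solve-∀
  big : ∀ d k → 5 * k + 11 ≤ n → j + j < n + k →
        ∀ b → n ≡ 3 + suc b → 4 * j + turán (4 + d) b ≤ turán (4 + d) (3 + b) + (k + 1)
  big (suc d) k n≥ j< b refl = s≤s⁻¹ (*-cancelˡ-< (5 + d) _ _ (≤-certificate (k * (5 + 4 * d) + 6 * d + 5)
    (+-mono-≤ (+-mono-≤ (*-monoʳ-≤ (2 * (5 + d)) j<) (*-monoʳ-≤ (2 + d) n≥)) (turán-rangeSum (4 + d) b 3))
    (identity d j b k (turán (5 + d) b) (turán (5 + d) (3 + b)))))
    where
    identity : ∀ d j b k x y →
      suc ((5 + d) * (4 * j + x)) + (2 * (5 + d) * (4 + b + k) + (2 + d) * (4 + b) + (5 + d) * y) + (k * (5 + 4 * d) + 6 * d + 5) ≡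
      (5 + d) * suc (y + (k + 1)) + (2 * (5 + d) * suc (j + j) + (2 + d) * (5 * k + 11) + ((5 + d) * x + (4 + d) * (0 + b + suc b + suc (suc b))))
    identity = solve-∀
  big zero (suc k) n≥ j< b refl = s≤s⁻¹ (*-cancelˡ-< 4 _ _ (≤-certificate k
    (+-mono-≤ (+-mono-≤ (*-monoʳ-≤ 8 j<) n≥) (turán-rangeSum 3 b 3)) (identity j b k (turán 4 b) (turán 4 (3 + b)))))
    where
    identity : ∀ j b k x y →
      suc (4 * (4 * j + x)) + (8 * (4 + b + suc k) + (4 + b) + 4 * y) + k ≡
      4 * suc (y + (suc k + 1)) + (8 * suc (j + j) + (5 * suc k + 11) + (4 * x + 3 * (0 + b + suc b + suc (suc b))))
    identity = solve-∀
  -- For k = 0 the preceding certificate would be short by 1; starting at n = 12, that is b = 8,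
  -- makes up for it.
  big zero zero n≥ j< b refl with 8 ≤? b
  ... | yes 8≤b = s≤s⁻¹ (*-cancelˡ-< 4 _ _ (≤-certificate 0
    (+-mono-≤ (+-mono-≤ (*-monoʳ-≤ 8 j<) 8≤b) (turán-rangeSum 3 b 3)) (identity j b (turán 4 b) (turán 4 (3 + b)))))
    where
    identity : ∀ j b x y →
      suc (4 * (4 * j + x)) + (8 * (4 + b + 0) + b + 4 * y) + 0 ≡
      4 * suc (y + (0 + 1)) + (8 * suc (j + j) + 8 + (4 * x + 3 * (0 + b + suc b + suc (suc b))))
    identity = solve-∀
  -- The estimate by averages is too weak in the single case n = 11, where the values are 18 and 37.
  ... | no b≱8 with ≤-antisym (s≤s⁻¹ (≰⇒> b≱8)) (+-cancelˡ-≤ 4 7 b n≥)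
  ...   | refl = +-monoˡ-≤ 18 (*-monoʳ-≤ 4 (j≤5 j j<))
    where
    j≤5 : ∀ j → j + j < 11 → j ≤ 5
    j≤5 j j< = ≮⇒≥ λ 6≤j → <⇒≱ j< (≤-trans (n≤1+n 11) (+-mono-≤ 6≤j 6≤j))

-- Three low vertices lose at most 3(n + k - 1)/2 edges, while two Turán degrees amount to about 2(r
-- - 1)n/r. The surplus is (r - 4)n/(2r); after multiplication by 2r the bound on n enters with its
-- factor r - 4 = `4 + v`.
deletion-8+ : ∀ n v k {L j} → (k + 5) * (4 + v) + 4 * (k + 4) ≤ n * (4 + v) → j + j < n + k →
              1 ≤ L → j ≤ L + k → Deletion n (8 + v) k L j
deletion-8+ n v k {L} {j} n≥ j< 1≤L j≤ = chooseDeletion (7 + v) k n 2 2<n 1≤L j≤ small big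
  where
  2<n : 2 < n
  2<n = ≤-trans (≤-trans (m≤m+n 3 2) (m≤n+m 5 k)) (*-cancelʳ-≤ (k + 5) n (4 + v) (m+n≤o⇒m≤o _ n≥))
  small : ∀ b i → n ≡ suc (suc i) + b → suc i < 2 → (8 + v) * (suc i + k + 2) ≤ (7 + v) * b
  small b zero refl _ = ≤-certificate (3 * b + 4) n≥ (identity b k v)
    where
    identity : ∀ b k v → (8 + v) * (1 + k + 2) + (2 + b) * (4 + v) + (3 * b + 4) ≡
                         (7 + v) * b + ((k + 5) * (4 + v) + 4 * (k + 4))
    identity = solve-∀
  small b (suc i) _ (s≤s (s≤s ()))
  big : ∀ b → n ≡ 2 + suc b → 3 * j + turán (8 + v) b ≤ turán (8 + v) (2 + b) + (k + 1)
  big b refl = *-cancelˡ-≤ (2 * (8 + v)) (≤-certificate 6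
    (+-mono-≤ (+-mono-≤ (*-monoʳ-≤ (3 * (8 + v)) j<) n≥) (*-monoʳ-≤ 2 (turán-rangeSum (7 + v) b 2)))
    (identity j b k v (turán (8 + v) b) (turán (8 + v) (2 + b))))
    where
    identity : ∀ j b k v x y →
      2 * (8 + v) * (3 * j + x) + (3 * (8 + v) * (3 + b + k) + (3 + b) * (4 + v) + 2 * ((8 + v) * y)) + 6 ≡
      2 * (8 + v) * (y + (k + 1)) + (3 * (8 + v) * suc (j + j) + ((k + 5) * (4 + v) + 4 * (k + 4)) +
        2 * ((8 + v) * x + (7 + v) * (0 + b + suc b)))
    identity = solve-∀

-- The extremal graphs: edges and non-Hamiltonicity

e-≅ : ∀ {m} {G H : Graph m} → G ≅ H → e G ≡ e H
e-≅ {m} {G} {H} iso = begin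
  e G                                           ≡⟨ e≡edges G ⟩
  edges (adj? G) (allFin m)                     ≡⟨ ≤-antisym
    (edges-mono (adj? G) onTo? (λ {i} {j} → Equivalence.to (adj-iff i j)) (allFin m))
    (edges-mono onTo? (adj? G) (λ {i} {j} → Equivalence.from (adj-iff i j)) (allFin m)) ⟩
  edges onTo? (allFin m)                        ≡⟨ edges-map (adj? H) to (allFin m) ⟨
  edges (adj? H) (map to (allFin m))            ≡⟨ edges-↭ (adj? H) (symm H) perm ⟩
  edges (adj? H) (allFin m)                     ≡⟨ e≡edges H ⟨
  e H                                           ∎
  where
  open ≡-Reasoning
  open _≅_ iso
  open Inverse bij using (to; from; strictlyInverseˡ; strictlyInverseʳ)
  onTo? : Decidable₂ (λ i j → Adj H (to i) (to j))
  onTo? i j = adj? H (to i) (to j)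
  perm : map to (allFin m) ↭ allFin m
  perm = unique-⇔⇒↭
    (Unique-map⁺ (λ {x} {y} eq → ≡-trans (sym (strictlyInverseʳ x)) (≡-trans (cong from eq) (strictlyInverseʳ y))) (allFin⁺ m))
    (allFin⁺ m) (λ _ → ∈-allFin _)
    (λ {x} _ → subst (_∈ map to (allFin m)) (strictlyInverseˡ x) (∈-map⁺ to (∈-allFin (from x))))

allFin↭punchIn : ∀ {m} (v : Fin (suc m)) → allFin (suc m) ↭ v ∷ map (punchIn v) (allFin m)
allFin↭punchIn {m} v = unique-⇔⇒↭ (allFin⁺ (suc m))
  (All.tabulate v∉ ∷ Unique-map⁺ (punchIn-injective v _ _) (allFin⁺ m)) (λ {x} _ → covers x) (λ _ → ∈-allFin _)
  where
  v∉ : ∀ {x} → x ∈ map (punchIn v) (allFin m) → v ≢ x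
  v∉ x∈ v≡x with ∈-map⁻ (punchIn v) x∈
  ... | i , _ , refl = punchInᵢ≢i v i (sym v≡x)
  covers : ∀ x → x ∈ v ∷ map (punchIn v) (allFin m)
  covers x with v ≟ x
  ... | yes refl = here refl
  ... | no  v≢x  = there (subst (_∈ map (punchIn v) (allFin m)) (punchIn-punchOut v≢x) (∈-map⁺ (punchIn v) (∈-allFin (punchOut v≢x))))

e-delete : ∀ {m} (G : Graph (suc m)) v → e G ≡ e (G -ᵥ v) + degree G v
e-delete {m} G v = begin
  e G                                                              ≡⟨ e≡edges G ⟩
  edges (adj? G) (allFin (suc m))                                  ≡⟨ edges-↭ (adj? G) (symm G) (allFin↭punchIn v) ⟩
  count (adj? G v) others + edges (adj? G) others                  ≡⟨ cong₂ _+_ deg rest ⟩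
  degree G v + e (G -ᵥ v)                                          ≡⟨ +-comm (degree G v) _ ⟩
  e (G -ᵥ v) + degree G v                                          ∎
  where
  open ≡-Reasoning
  others = map (punchIn v) (allFin m)
  deg : count (adj? G v) others ≡ degree G v
  deg = ≡-trans (sym (count-reject (adj? G v) (irrefl G refl))) (sym (count-↭ (adj? G v) (allFin↭punchIn v)))
  rest : edges (adj? G) others ≡ e (G -ᵥ v)
  rest = ≡-trans (edges-map (adj? G) (punchIn v) (allFin m)) (sym (e≡edges (G -ᵥ v)))

Unique-++-disjoint : ∀ {x : A} xs {ys} → Unique (xs ++ ys) → x ∈ xs → x ∉ ys
Unique-++-disjoint (x ∷ xs) (x≢ ∷ u) (here refl) x∈ys = All.lookup x≢ (∈-++⁺ʳ xs x∈ys) refl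
Unique-++-disjoint (x ∷ xs) (_ ∷ u)  (there x∈)  x∈ys = Unique-++-disjoint xs u x∈ x∈ys

rotate : ∀ {v : A} {s xs} → v ∈ s ∷ xs →
         ∃ λ ys → s ∷ xs ↭ v ∷ ys × steps (s ∷ xs ∷ʳ s) ↭ steps (v ∷ ys ∷ʳ v)
rotate {v = v} v∈ with ∈-∃++ v∈
... | []      , B , refl = B , ↭-refl , ↭-refl
... | s ∷ A′ , B , refl = B ++ s ∷ A′ , ↭-++-comm (s ∷ A′) (v ∷ B) ,
  ↭-trans (↭-reflexive old) (↭-trans (↭-++-comm (steps (s ∷ A′ ∷ʳ v)) _) (↭-reflexive (sym new)))
  where
  old : steps ((s ∷ A′ ++ v ∷ B) ∷ʳ s) ≡ steps (s ∷ A′ ∷ʳ v) ++ steps (v ∷ B ∷ʳ s)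
  old = ≡-trans (cong steps (++-assoc (s ∷ A′) (v ∷ B) (s ∷ []))) (steps-++ (s ∷ A′) v (B ∷ʳ s))
  new : steps (v ∷ (B ++ s ∷ A′) ∷ʳ v) ≡ steps (v ∷ B ∷ʳ s) ++ steps (s ∷ A′ ∷ʳ v)
  new = ≡-trans (cong steps (++-assoc (v ∷ B) (s ∷ A′) (v ∷ []))) (steps-++ (v ∷ B) s (A′ ∷ʳ v))

steps-⊆ : ∀ {a b : A} xs → (a , b) ∈ steps xs → a ∈ xs × b ∈ xs
steps-⊆ xs ab∈ with ∈-steps xs ab∈
... | ys , zs , refl = ∈-insert ys , ∈-++⁺ʳ ys (there (here refl))

first-step : ∀ (a : A) xs z → ∃ λ x → x ∈ xs ∷ʳ z × (a , x) ∈ steps (a ∷ xs ∷ʳ z)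
first-step a []       z = z , here refl , here refl
first-step a (x ∷ xs) z = x , here refl , here refl

last-step : ∀ (a : A) xs z → ∃ λ x → x ∈ a ∷ xs × (x , z) ∈ steps (a ∷ xs ∷ʳ z)
last-step a []       z = a , here refl , here refl
last-step a (x ∷ xs) z with last-step x xs z
... | y , y∈ , yz∈ = y , there y∈ , there yz∈

module _ {n : ℕ} where

  open import Data.List.Membership.DecPropositional (_≟_ {n}) using (_∈?_)

  Unique-⊆-length : {xs ys : List (Fin n)} → Unique xs → Unique ys → (∀ {x} → x ∈ xs → x ∈ ys) → length xs ≤ length ys
  Unique-⊆-length {xs} {ys} ux uy xs⊆ys = ≤-trans
    (≤-reflexive (↭-length (unique-⇔⇒↭ ux (filter⁺ (_∈? xs) uy) (λ x∈ → ∈-filter⁺ (_∈? xs) (xs⊆ys x∈) x∈)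
                                       (proj₂ ∘ ∈-filter⁻ (_∈? xs) {xs = ys}))))
    (count≤length (_∈? xs) ys)

  Unique-escape : {xs ys : List (Fin n)} → Unique xs → Unique ys → length ys < length xs → ∃ λ x → x ∈ xs × x ∉ ys
  Unique-escape {xs} {ys} ux uy ys<xs with All.all? (_∈? ys) xs
  ... | yes xs⊆ys = contradiction (Unique-⊆-length ux uy (All.lookup xs⊆ys)) (<⇒≱ ys<xs)
  ... | no ¬⊆ = find (¬All⇒Any¬ (_∈? ys) xs ¬⊆)

  module _ {G : Graph n} {v : Fin n} (P : Path G) (C : HamiltonianCycle G) (P⊆C : P ContainedIn proj₁ C)
           (⊆N : ∀ {x} → x ∈ Path.walk P → Adj G v x) (N⊆ : ∀ {x} → Adj G v x → x ∈ Path.walk P)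
           (large : suc (length (Path.walk P)) < n) where

    open Path P
    open Cycle (proj₁ C) using () renaming (start to s; rest to xs)

    neighbourhood-path-not-extendable : ⊥
    neighbourhood-path-not-extendable with rotate (proj₂ C v)
    ... | X , perm , steps↭ with Unique-resp-↭ perm (Cycle.distinct (proj₁ C))
    ...   | v∉X ∷ uX with Unique-escape uX distinct W<X
      where
      W<X : length walk < length X
      W<X = s≤s⁻¹ (≤-trans large (≤-reflexive (≡-trans (sym (length-tabulate (λ x → x)))
              (↭-length (↭-trans (unique-⇔⇒↭ (allFin⁺ n) (Cycle.distinct (proj₁ C))
                                      (λ _ → proj₂ C _) (λ _ → ∈-allFin _)) perm)))))
    ...     | z , z∈X , z∉W with ∈-∃++ z∈X
    -- `X₁` is the arc from `v` to `z` and `X₂` the arc from `z` back to `v`, both without their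
    -- ends.
    ...       | X₁ , X₂ , refl = conclude (side (here refl))
      where
      adjacent : All (uncurry (Adj G)) (steps (v ∷ (X₁ ++ z ∷ X₂) ∷ʳ v))
      adjacent = All-resp-↭ steps↭ (Linked⇒All-steps (Cycle.linked (proj₁ C)))
      arcs : steps (v ∷ (X₁ ++ z ∷ X₂) ∷ʳ v) ≡ steps (v ∷ X₁ ∷ʳ z) ++ steps (z ∷ X₂ ∷ʳ v)
      arcs = ≡-trans (cong steps (++-assoc (v ∷ X₁) (z ∷ X₂) (v ∷ []))) (steps-++ (v ∷ X₁) z (X₂ ∷ʳ v))
      disjoint : ∀ {x} → x ∈ X₁ → x ∉ X₂
      disjoint x∈₁ x∈₂ = Unique-++-disjoint X₁ uX x∈₁ (there x∈₂)
      SameArc : Rel (Fin n) 0ℓ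
      SameArc a b = (a ∈ X₁ × b ∈ X₁) ⊎ (a ∈ X₂ × b ∈ X₂)
      v∉walk : v ∉ walk
      v∉walk v∈ = irrefl G refl (⊆N v∈)
      in-X₁ˡ : ∀ {a} → a ∈ walk → a ∈ v ∷ X₁ → a ∈ X₁
      in-X₁ˡ a∈ (here refl) = contradiction a∈ v∉walk
      in-X₁ˡ a∈ (there a∈₁) = a∈₁
      in-X₁ʳ : ∀ {a} → a ∈ walk → a ∈ X₁ ∷ʳ z → a ∈ X₁
      in-X₁ʳ a∈ a∈₁ with ∈-++⁻ X₁ a∈₁
      ... | inj₁ a∈′         = a∈′
      ... | inj₂ (here refl) = contradiction a∈ z∉W
      in-X₂ˡ : ∀ {a} → a ∈ walk → a ∈ z ∷ X₂ → a ∈ X₂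
      in-X₂ˡ a∈ (here refl) = contradiction a∈ z∉W
      in-X₂ˡ a∈ (there a∈₂) = a∈₂
      in-X₂ʳ : ∀ {a} → a ∈ walk → a ∈ X₂ ∷ʳ v → a ∈ X₂
      in-X₂ʳ a∈ a∈₂ with ∈-++⁻ X₂ a∈₂
      ... | inj₁ a∈′         = a∈′
      ... | inj₂ (here refl) = contradiction a∈ v∉walk
      sameArc : ∀ {a b} → a ∈ walk → b ∈ walk → (a , b) ∈ steps (s ∷ xs ∷ʳ s) → SameArc a b
      sameArc {a} {b} a∈ b∈ ab∈
        with ∈-++⁻ (steps (v ∷ X₁ ∷ʳ z)) (subst ((a , b) ∈_) arcs (∈-resp-↭ steps↭ ab∈))
      ... | inj₁ ab∈₁ = inj₁ ( in-X₁ˡ a∈ (subst (a ∈_) (steps-firsts (v ∷ X₁) z) (∈-map⁺ proj₁ ab∈₁))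
                             , in-X₁ʳ b∈ (subst (b ∈_) (steps-seconds v (X₁ ∷ʳ z)) (∈-map⁺ proj₂ ab∈₁)) )
      ... | inj₂ ab∈₂ = inj₂ ( in-X₂ˡ a∈ (subst (a ∈_) (steps-firsts (z ∷ X₂) v) (∈-map⁺ proj₁ ab∈₂))
                             , in-X₂ʳ b∈ (subst (b ∈_) (steps-seconds z (X₂ ∷ʳ v)) (∈-map⁺ proj₂ ab∈₂)) )
      walkArcs : All (uncurry SameArc) (steps walk)
      walkArcs = All.tabulate λ {ab} ab∈ → arc ab∈ (_ContainedIn_.edges⊆ P⊆C ab∈)
        where
        arc : ∀ {a b} → (a , b) ∈ steps walk → (a , b) ∈ steps (s ∷ xs ∷ʳ s) ⊎ (b , a) ∈ steps (s ∷ xs ∷ʳ s) → SameArc a b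
        arc ab∈ (inj₁ ab∈C) = sameArc (proj₁ (steps-⊆ walk ab∈)) (proj₂ (steps-⊆ walk ab∈)) ab∈C
        arc ab∈ (inj₂ ba∈C) = Sum.map swap× swap× (sameArc (proj₂ (steps-⊆ walk ab∈)) (proj₁ (steps-⊆ walk ab∈)) ba∈C)
      propagate₁ : ∀ w ws → All (uncurry SameArc) (steps (w ∷ ws)) → w ∈ X₁ → All (_∈ X₁) (w ∷ ws)
      propagate₁ w []        _                       w∈ = w∈ ∷ []
      propagate₁ w (w′ ∷ ws) (inj₁ (_ , w′∈) ∷ arcs) w∈ = w∈ ∷ propagate₁ w′ ws arcs w′∈
      propagate₁ w (w′ ∷ ws) (inj₂ (w∈₂ , _) ∷ arcs) w∈ = contradiction w∈₂ (disjoint w∈)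
      propagate₂ : ∀ w ws → All (uncurry SameArc) (steps (w ∷ ws)) → w ∈ X₂ → All (_∈ X₂) (w ∷ ws)
      propagate₂ w []        _                       w∈ = w∈ ∷ []
      propagate₂ w (w′ ∷ ws) (inj₂ (_ , w′∈) ∷ arcs) w∈ = w∈ ∷ propagate₂ w′ ws arcs w′∈
      propagate₂ w (w′ ∷ ws) (inj₁ (w∈₁ , _) ∷ arcs) w∈ = contradiction w∈ (disjoint w∈₁)
      -- The vertex after `v` on the cycle is a neighbour of `v`, hence on the path, hence not `z`;
      -- so it belongs to the first arc.
      successor : ∃ λ x → x ∈ X₁ × x ∈ walk
      successor with first-step v X₁ z
      ... | x , x∈ , vx∈ =
        let x∈W = N⊆ (All.lookup adjacent (subst ((v , x) ∈_) (sym arcs) (∈-++⁺ˡ vx∈)))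
        in  x , in-X₁ʳ x∈W x∈ , x∈W
      predecessor : ∃ λ x → x ∈ X₂ × x ∈ walk
      predecessor with last-step z X₂ v
      ... | x , x∈ , xv∈ =
        let x∈W = N⊆ (symm G (All.lookup adjacent (subst ((x , v) ∈_) (sym arcs) (∈-++⁺ʳ (steps (v ∷ X₁ ∷ʳ z)) xv∈))))
        in  x , in-X₂ˡ x∈W x∈ , x∈W
      side : ∀ {x} → x ∈ walk → x ∈ X₁ ⊎ x ∈ X₂
      side x∈ with ∈-resp-↭ perm (_ContainedIn_.vertices⊆ P⊆C x∈)
      ... | here refl = contradiction x∈ v∉walk
      ... | there x∈X with ∈-++⁻ X₁ x∈X
      ...   | inj₁ x∈₁ = inj₁ x∈₁
      ...   | inj₂ x∈₂ = inj₂ (in-X₂ˡ x∈ x∈₂)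
      conclude : start ∈ X₁ ⊎ start ∈ X₂ → ⊥
      conclude (inj₁ s∈₁) with predecessor
      ... | _ , x∈₂ , x∈W = disjoint (All.lookup (propagate₁ start rest walkArcs s∈₁) x∈W) x∈₂
      conclude (inj₂ s∈₂) with successor
      ... | _ , x∈₁ , x∈W = disjoint x∈₁ (All.lookup (propagate₂ start rest walkArcs s∈₂) x∈W)

lookup-injective : {xs : List A} → Unique xs → ∀ {i j} → lookup xs i ≡ lookup xs j → i ≡ j
lookup-injective u {i} {j} eq = decidable-stable (i ≟ j) λ i≢j → AllPairs-lookup (λ x≢y → x≢y ∘ sym) u i j i≢j eq

-- The Hamiltonian path of the neighbourhood has k + 1 vertices and so the admissible length `k`. As
-- n > k + 2, some vertex lies outside `v` and its neighbours.
𝒥-notPathHamiltonian : ∀ r k .{{_ : NonZero r}} {n} (G : Graph n) → suc (suc k) < n → 𝒥 r k G → ¬ (k -PathHamiltonian G)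
𝒥-notPathHamiltonian r k {suc m} G k+2<n (_ , v , _ , deg , path , covers) ham =
  neighbourhood-path-not-extendable P (proj₁ extended) (proj₂ extended) ⊆N N⊆
    (subst (λ l → suc l < suc m) (sym (≡-trans (length-map (lookup N) walk) length-walk)) k+2<n)
  where
  open Path path
  N = neighbours G v
  length-walk : length walk ≡ suc k
  length-walk = ≡-trans (↭-length (unique-⇔⇒↭ distinct (allFin⁺ (degree G v)) (λ _ → ∈-allFin _) (λ _ → covers _)))
                        (≡-trans (length-tabulate (λ x → x)) deg)
  P : Path G
  P = record
    { start    = lookup N start
    ; rest     = map (lookup N) rest
    ; distinct = Unique-map⁺ (lookup-injective (filter⁺ (adj? G v) (allFin⁺ (suc m)))) distinct
    ; linked   = Linked.map⁺ linked
    }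
  extended : Σ (HamiltonianCycle G) λ C → P ContainedIn proj₁ C
  extended = ham P (≤-reflexive (≡-trans (length-map (lookup N) rest) (suc-injective length-walk)))
  ⊆N : ∀ {x} → x ∈ Path.walk P → Adj G v x
  ⊆N x∈ with ∈-map⁻ (lookup N) x∈
  ... | i , _ , refl = proj₂ (∈-filter⁻ (adj? G v) {xs = allFin (suc m)} (∈-lookup i))
  N⊆ : ∀ {x} → Adj G v x → x ∈ Path.walk P
  N⊆ {x} vx = subst (_∈ Path.walk P) (sym (lookup-index x∈N)) (∈-map⁺ (lookup N) (covers (Any.index x∈N)))
    where x∈N = ∈-filter⁺ (adj? G v) (∈-allFin x) vx

𝒥-edges : ∀ r k .{{_ : NonZero r}} {n} (G : Graph n) → 𝒥 r k G → e G ≡ e (T r (n ∸ 1)) + (k + 1)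
𝒥-edges r k {suc m} G (_ , v , iso , deg , _) =
  ≡-trans (e-delete G v) (cong₂ _+_ (e-≅ iso) (≡-trans deg (+-comm 1 k)))

-- The extremal graphs: existence

map-filter : {P : Pred A 0ℓ} {Q : Pred B 0ℓ} (P? : Decidable P) (Q? : Decidable Q) (f : A → B) →
             ∀ xs → (∀ {x} → x ∈ xs → P x → Q (f x)) → (∀ {x} → x ∈ xs → Q (f x) → P x) →
             map f (filter P? xs) ≡ filter Q? (map f xs)
map-filter P? Q? f []       P⇒Q Q⇒P = refl
map-filter P? Q? f (x ∷ xs) P⇒Q Q⇒P with P? x | Q? (f x)
... | yes _ | yes _ = cong (f x ∷_) (map-filter P? Q? f xs (P⇒Q ∘ there) (Q⇒P ∘ there))
... | no _  | no _  = map-filter P? Q? f xs (P⇒Q ∘ there) (Q⇒P ∘ there)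
... | yes p | no ¬q = contradiction (P⇒Q (here refl) p) ¬q
... | no ¬p | yes q = contradiction (Q⇒P (here refl) q) ¬p

-- A discrete intermediate value argument: each further number raises the count by at most 1.
count-intermediate : {P : Pred ℕ 0ℓ} (P? : Decidable P) → ∀ {c} m → c ≤ count P? (downFrom m) →
                     ∃ λ M → M ≤ m × count P? (downFrom M) ≡ c
count-intermediate P? zero c≤ = 0 , z≤n , sym (n≤0⇒n≡0 c≤)
count-intermediate P? {c} (suc m) c≤ with c ≤? count P? (downFrom m)
... | yes c≤′ = let M , M≤m , eq = count-intermediate P? m c≤′ in M , m≤n⇒m≤1+n M≤m , eq
... | no c≰ = suc m , ≤-refl , ≤-antisym (≤-trans (count-∷-suc P? m (downFrom m)) (≰⇒> c≰)) c≤

lookup-traceable : ∀ {n} (G : Graph n) N → 0 < length N → Linked (Adj G) N → Traceable (induced G (lookup N))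
lookup-traceable G N@(x ∷ xs) _ linked = record
  { start    = zero
  ; rest     = tabulate suc
  ; distinct = allFin⁺ (length N)
  ; linked   = Linked.map⁻ (subst (Linked (Adj G)) (sym (≡-trans (map-tabulate (λ i → i) (lookup N)) (tabulate-lookup N))) linked)
  } , ∈-allFin

module Construction (r m k M : ℕ) .{{_ : NonZero r}} (2<r : 2 < r) (M≤m : M ≤ m)
  (count-M : count (distinctPart? r m) (downFrom M) ≡ suc k) where

  -- Vertex 0 plays the role of the last vertex m of T r (suc m).
  label : Fin (suc m) → ℕ
  label zero    = m
  label (suc i) = toℕ i

  Distinct : Rel ℕ 0ℓ
  Distinct i j = i mod r ≢ j mod r

  -- This is T_r(m + 1) with the edges at its last vertex cut down to the labels below `M`. The
  -- condition reads `toℕ b ≤ M` because the vertex `suc i` carries the label `toℕ i`.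
  G : Graph (suc m)
  G = record
    { Adj    = λ a b → Distinct (label a) (label b) × (a ≡ zero → toℕ b ≤ M) × (b ≡ zero → toℕ a ≤ M)
    ; adj?   = λ a b → distinctPart? r (label a) (label b) ×-dec ((a ≟ zero) →-dec (toℕ b ≤? M))
                                                          ×-dec ((b ≟ zero) →-dec (toℕ a ≤? M))
    ; symm   = λ (a≢b , a , b) → a≢b ∘ sym , b , a
    ; irrefl = λ { refl (a≢a , _) → a≢a refl }
    }

  free : K (suc r) Free G
  free K↪G with pigeonhole (n<1+n r) (λ i → label (_↪_.emb K↪G i) mod r)
  ... | i , j , i<j , eq = proj₁ (_↪_.preserves K↪G i j (λ { refl → <⇒≢ i<j refl })) eq

  deleted : (G -ᵥ zero) ≅ T r m
  deleted = record
    { bij     = ↔-id (Fin m)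
    ; adj-iff = λ i j → mk⇔ proj₁ (λ i≢j → i≢j , (λ ()) , λ ())
    }

  Joined : Pred ℕ 0ℓ
  Joined i = i < M × Distinct m i

  -- Abstract, because the unfolded decision procedure blocks with-abstraction under filter.
  abstract
    joined? : Decidable Joined
    joined? i = (i <? M) ×-dec distinctPart? r m i

  N : List (Fin (suc m))
  N = neighbours G zero

  labels-N : map label N ≡ filter joined? (upTo m)
  labels-N = begin
    map label N
      ≡⟨ cong (map label) (filter-reject (adj? G zero) (irrefl G refl)) ⟩
    map label (filter (adj? G zero) (tabulate suc))
      ≡⟨ map-filter (adj? G zero) joined? label (tabulate suc) to from ⟩
    filter joined? (map label (tabulate suc))
      ≡⟨ cong (filter joined?) (≡-trans (map-tabulate suc label) (tabulate-toℕ (λ i → i) m)) ⟩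
    filter joined? (upTo m) ∎
    where
    open ≡-Reasoning
    to : ∀ {x} → x ∈ tabulate suc → Adj G zero x → Joined (label x)
    to x∈ (m≢x , x≤M , _) with ∈-tabulate⁻ x∈
    ... | i , refl = x≤M refl , m≢x
    from : ∀ {x} → x ∈ tabulate suc → Joined (label x) → Adj G zero x
    from x∈ (x<M , m≢x) with ∈-tabulate⁻ x∈
    ... | i , refl = m≢x , (λ _ → x<M) , λ ()

  count-joined : ∀ d → count joined? (downFrom (d + M)) ≡ count (distinctPart? r m) (downFrom M)
  count-joined zero    = ≤-antisym
    (count-mono joined? (distinctPart? r m) (downFrom M) (λ _ → proj₂))
    (count-mono (distinctPart? r m) joined? (downFrom M) (λ i∈ m≢i → ∈-downFrom⁻ i∈ , m≢i))
  count-joined (suc d) = ≡-trans (count-reject joined? (λ (lt , _) → <⇒≱ lt (m≤n+m M d))) (count-joined d)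

  degree-zero : degree G zero ≡ suc k
  degree-zero = begin
    length N                                 ≡⟨ length-map label N ⟨
    length (map label N)                     ≡⟨ cong length labels-N ⟩
    count joined? (upTo m)                   ≡⟨ count-↭ joined? (↭-reverse (upTo m)) ⟨
    count joined? (reverse (upTo m))         ≡⟨ cong (count joined?) (reverse-upTo m) ⟩
    count joined? (downFrom m)               ≡⟨ cong (count joined? ∘ downFrom) (m∸n+n≡m M≤m) ⟨
    count joined? (downFrom (m ∸ M + M))     ≡⟨ count-joined (m ∸ M) ⟩
    count (distinctPart? r m) (downFrom M)   ≡⟨ count-M ⟩
    suc k                                    ∎
    where open ≡-Reasoning

  Next : Rel ℕ 0ℓ
  Next i j = j ≡ suc i

  distinct-shift : ∀ a i → 0 < a → a < r → Distinct i (a + i)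
  distinct-shift a i 0<a a<r eq = %-shift r a i 0<a a<r
    (≡-trans (sym (toℕ-mod r (a + i))) (≡-trans (cong toℕ (sym eq)) (toℕ-mod r i)))

  beyond : ∀ {i xs} → M ≤ i → Linked Next (i ∷ xs) → filter joined? xs ≡ []
  beyond M≤i [-]         = refl
  beyond M≤i (refl ∷ ls) = ≡-trans (filter-reject joined? (λ (lt , _) → <⇒≱ lt (m≤n⇒m≤1+n M≤i)))
                                   (beyond (m≤n⇒m≤1+n M≤i) ls)

  -- Below `M` only the labels in the class of `m` are unjoined, and two consecutive numbers are
  -- never both in it.
  unjoined : ∀ i → ¬ Joined i → ¬ Joined (suc i) → M ≤ suc i
  unjoined i ¬i ¬1+i with suc i <? M
  ... | no  i≮ = ≮⇒≥ i≮
  ... | yes i< = contradiction (≡-trans (sym (same i (λ d → ¬i (<-trans (n<1+n i) i< , d)))) (same (suc i) (λ d → ¬1+i (i< , d))))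
                               (distinct-shift 1 i z<s (<-trans (n<1+n 1) 2<r))
    where
    same : ∀ j → ¬ Distinct m j → m mod r ≡ j mod r
    same j = decidable-stable ((m mod r) ≟ (j mod r))

  -- Two labels in the class of m are not consecutive, so at most one is skipped at a time before M.
  linked-from : ∀ {i xs} → Linked Next (i ∷ xs) → Linked Distinct (i ∷ filter joined? xs)
  linked-from [-] = [-]
  linked-from {i} (refl ∷ ls) with joined? (suc i)
  ... | yes _ = distinct-shift 1 i z<s (<-trans (n<1+n 1) 2<r) ∷ linked-from ls
  linked-from {i} (refl ∷ [-]) | no _ = [-]
  linked-from {i} (refl ∷ refl ∷ ls) | no ¬1+i with joined? (suc (suc i))
  -- Here r ≥ 3 enters: labels that differ by 2 lie in different parts.
  ... | yes _   = distinct-shift 2 i z<s 2<r ∷ linked-from ls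
  ... | no ¬2+i = subst (λ xs → Linked Distinct (i ∷ xs)) (sym (beyond (unjoined (suc i) ¬1+i ¬2+i) ls)) [-]

  linked-joined : ∀ {xs} → Linked Next xs → Linked Distinct (filter joined? xs)
  linked-joined {[]}     _  = []
  linked-joined {i ∷ xs} ls with joined? i
  ... | yes _ = linked-from ls
  ... | no _  = linked-joined (Linked.tail ls)

  linked-N : Linked (Adj G) N
  linked-N = All-steps⇒Linked N (All.tabulate adjacent)
    where
    labels : Linked (Distinct on label) N
    labels = Linked.map⁻ (subst (Linked Distinct) (sym labels-N) (linked-joined (Linked.applyUpTo⁺₂ (λ i → i) m (λ _ → refl))))
    nonzero : ∀ {x} → x ∈ N → x ≢ zero
    nonzero x∈ refl = irrefl G refl (proj₂ (∈-filter⁻ (adj? G zero) {xs = allFin (suc m)} x∈))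
    adjacent : ∀ {ab} → ab ∈ steps N → Adj G (proj₁ ab) (proj₂ ab)
    adjacent ab∈ = All.lookup (Linked⇒All-steps labels) ab∈
                 , (λ a≡0 → contradiction a≡0 (nonzero (proj₁ (steps-⊆ N ab∈))))
                 , (λ b≡0 → contradiction b≡0 (nonzero (proj₂ (steps-⊆ N ab∈))))

  G∈𝒥 : 𝒥 r k G
  G∈𝒥 = free , zero , deleted , degree-zero , lookup-traceable G N (subst (0 <_) (sym degree-zero) z<s) linked-N

-- The last vertex of T_r(m + 1) has at least `m ∸ m / r` neighbours, so a suitable cut-off `M`
-- trims its degree to exactly k + 1.
𝒥-nonempty : ∀ r k m .{{_ : NonZero r}} → 2 < r → suc k ≤ m ∸ m / r → ∃ λ (G : Graph (suc m)) → 𝒥 r k G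
𝒥-nonempty r k m 2<r k< =
  let M , M≤m , eq = count-intermediate (distinctPart? r m) m (≤-trans k< (count-distinctPart r m))
  in  Construction.G r m k M 2<r M≤m eq , Construction.G∈𝒥 r m k M 2<r M≤m eq

-- The three ranges of r

-- These are the uses of the size hypothesis: `order` keeps n above k + 2, `deletion` drives the
-- upper bound, and `room` supplies the k + 1 neighbours of the added vertex in the construction.
record Numerics (n r k : ℕ) .{{_ : NonZero r}} : Set where
  field
    order    : k + 5 ≤ n
    deletion : ∀ {L j} → j + j < n + k → 1 ≤ L → j ≤ L + k → Deletion n r k L j
    room     : suc k ≤ (n ∸ 1) ∸ (n ∸ 1) / r

room-from : ∀ r′ {k} m → suc r′ * suc k ≤ r′ * m → suc k ≤ m ∸ m / suc r′
room-from r′ {k} m h = *-cancelˡ-≤ (suc r′) (≤-trans h (turánDegree≥ r′ m))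

numerics-3 : ∀ n k → 6 * k + 26 ≤ n → Numerics n 3 k
numerics-3 zero    k n≥ = contradiction (m+n≤o⇒n≤o (6 * k) n≥) λ ()
numerics-3 (suc m) k n≥ = record
  { order    = ≤-trans (≤-trans (m≤m+n (k + 5) (5 * k + 21)) (≤-reflexive (identity₁ k))) n≥
  ; deletion = deletion-3 (suc m) k n≥
  ; room     = room-from 2 m (≤-certificate (9 * k + 47) (*-monoʳ-≤ 2 n≥) (identity₂ m k))
  }
  where
  identity₁ : ∀ k → k + 5 + (5 * k + 21) ≡ 6 * k + 26
  identity₁ = solve-∀
  identity₂ : ∀ m k → 3 * suc k + 2 * suc m + (9 * k + 47) ≡ 2 * m + 2 * (6 * k + 26)
  identity₂ = solve-∀

numerics-4+ : ∀ n d k → 5 * k + 11 ≤ n → Numerics n (4 + d) k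
numerics-4+ zero    d k n≥ = contradiction (m+n≤o⇒n≤o (5 * k) n≥) λ ()
numerics-4+ (suc m) d k n≥ = record
  { order    = ≤-trans (≤-trans (m≤m+n (k + 5) (4 * k + 6)) (≤-reflexive (identity₁ k))) n≥
  ; deletion = deletion-4+ (suc m) d k n≥
  ; room     = room-from (3 + d) m (≤-certificate (k * (11 + 4 * d) + (26 + 9 * d)) (*-monoʳ-≤ (3 + d) n≥) (identity₂ d m k))
  }
  where
  identity₁ : ∀ k → k + 5 + (4 * k + 6) ≡ 5 * k + 11
  identity₁ = solve-∀
  identity₂ : ∀ d m k → (4 + d) * suc k + (3 + d) * suc m + (k * (11 + 4 * d) + (26 + 9 * d)) ≡
                        (3 + d) * m + (3 + d) * (5 * k + 11)
  identity₂ = solve-∀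

numerics-8+ : ∀ n v k → (k + 5) * (4 + v) + 4 * (k + 4) ≤ n * (4 + v) → Numerics n (8 + v) k
numerics-8+ n v k n≥ = record
  { order    = order
  ; deletion = deletion-8+ n v k n≥
  ; room     = room n (≤-trans (m≤n+m 5 k) order) n≥
  }
  where
  order : k + 5 ≤ n
  order = *-cancelʳ-≤ (k + 5) n (4 + v) (m+n≤o⇒m≤o _ n≥)
  identity : ∀ m k v → (8 + v) * suc k + suc m * (4 + v) + (3 * m + 3 * v + 24) ≡
                       (7 + v) * m + ((k + 5) * (4 + v) + 4 * (k + 4))
  identity = solve-∀
  room : ∀ n → 5 ≤ n → (k + 5) * (4 + v) + 4 * (k + 4) ≤ n * (4 + v) → suc k ≤ (n ∸ 1) ∸ (n ∸ 1) / (8 + v)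
  room (suc m) _ n≥ = room-from (7 + v) m (≤-certificate (3 * m + 3 * v + 24) n≥ (identity m k v))

numerics : (n r k : ℕ) .{{_ : NonZero r}} → 3 ≤ r →
  (r ≡ 3 → 6 * k + 26 ≤ n) →
  (4 ≤ r → r ≤ 7 → 5 * k + 11 ≤ n) →
  (8 ≤ r → (k + 5) * (r ∸ 4) + 4 * (k + 4) ≤ n * (r ∸ 4)) →
  Numerics n r k
numerics n (suc (suc zero))           k (s≤s (s≤s ()))
numerics n (suc (suc (suc zero)))    k 3≤r n≥₃ _ _ = numerics-3 n k (n≥₃ refl)
numerics n (suc (suc (suc (suc d)))) k 3≤r _ n≥₄ n≥₈ with d ≤? 3
... | yes d≤3 = numerics-4+ n d k (n≥₄ (m≤m+n 4 d) (+-monoʳ-≤ 4 d≤3))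
... | no d≰3 with m≤n⇒∃[o]m+o≡n (≰⇒> d≰3)
...   | v , refl = numerics-8+ n v k (n≥₈ (m≤m+n 8 v))

theorem4p4 : (n r k : ℕ) .{{_ : NonZero r}} → 3 ≤ r →
    (r ≡ 3 → 6 * k + 26 ≤ n) →
    (4 ≤ r → r ≤ 7 → 5 * k + 11 ≤ n) →
    (8 ≤ r → (k + 5) * (r ∸ 4) + 4 * (k + 4) ≤ n * (r ∸ 4)) →
    (∀ (G : Graph n) → K (suc r) Free G → ¬ (k -PathHamiltonian G) →
    e G ≤ e (T r (n ∸ 1)) + (k + 1))
    × (∃ λ (G : Graph n) → 𝒥 r k G)
    × (∀ (G : Graph n) → 𝒥 r k G →
    ¬ (k -PathHamiltonian G) × e G ≡ e (T r (n ∸ 1)) + (k + 1))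
theorem4p4 n r k 3≤r n≥₃ n≥₄ n≥₈ =
    upperBound
  , nonempty n order room
  , λ G G∈𝒥 → 𝒥-notPathHamiltonian r k G (k+ 3 (m≤m+n 3 2)) G∈𝒥 , 𝒥-edges r k G G∈𝒥
  where
  open Numerics (numerics n r k 3≤r n≥₃ n≥₄ n≥₈)
  k+ : ∀ i → i ≤ 5 → i + k ≤ n
  k+ i i≤5 = ≤-trans (≤-trans (+-monoˡ-≤ k i≤5) (≤-reflexive (+-comm 5 k))) order
  nonempty : ∀ n → k + 5 ≤ n → suc k ≤ (n ∸ 1) ∸ (n ∸ 1) / r → ∃ λ (G : Graph n) → 𝒥 r k G
  nonempty zero    order room = contradiction (m+n≤o⇒n≤o k order) λ ()
  nonempty (suc m) order room = 𝒥-nonempty r k m 3≤r room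
  upperBound : ∀ (G : Graph n) → K (suc r) Free G → ¬ (k -PathHamiltonian G) → e G ≤ e (T r (n ∸ 1)) + (k + 1)
  upperBound G free ¬ham with e G ≤? e (T r (n ∸ 1)) + (k + 1)
  ... | yes e≤ = e≤
  ... | no e≰ = contradiction (chvátal G k (≤-trans (m≤m+n 3 k) (k+ 3 (m≤m+n 3 2))) (k+ 2 (m≤m+n 2 3)) sparse) ¬ham
    where
    sparse : ∀ j → j + j < n + k → 1 ≤ lowDegreeCount G j → j ≤ lowDegreeCount G j + k → ⊥
    sparse j j< 1≤ j≤ with deletion j< 1≤ j≤
    ... | q , q≤ , bound = e≰ (begin
      e G                                  ≤⟨ e-deleteLow G q r free q≤ ⟩
      q * j + turán r (n ∸ q)              ≤⟨ bound ⟩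
      turán r (n ∸ 1) + (k + 1)            ≤⟨ +-monoˡ-≤ (k + 1) (turán≤e r (n ∸ 1)) ⟩
      e (T r (n ∸ 1)) + (k + 1)            ∎)
      where open ≤-Reasoning
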